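{- The dimension of the Dressian $\mathrm{Dr}(3,n)$, viewed as a polyhedral complex, is of order $\Theta(n^2)$ as $n\to\infty$.
   Context: The Dressian $\mathrm{Dr}(3,n)\subseteq\mathbb{R}^{\binom{n}{3}}$ is the set of $\lambda$ (indexed by $3$-subsets of $[n]$) such that for all pairwise distinct $h,i,j,k,l\in[n]$ the minimum of $\lambda_{hij}+\lambda_{hkl},\ \lambda_{hik}+\lambda_{hjl},\ \lambda_{hil}+\lambda_{hjk}$ is attained at least twice; equivalently, the set of weight vectors inducing regular matroid subdivisions of the hypersimplex $\Delta(3,n)$. It is a polyhedral fan with an $n$-dimensional lineality space; viewed as a polyhedral complex, it is the pointed fan obtained by factoring out the lineality space, intersected with the unit sphere (so its dimension is one less than the maximal dimension of a cone of the pointed fan).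
   Formalization: The Dressian is taken as a set of rational (not real) vectors, and its dimension is the largest dimension of a simplex with rational vertices whose rational points all lie in it, less n+1 for the lineality space and the sphere. -}

module Defs where

open import Data.Nat as ℕ using (ℕ; zero; suc)
open import Data.Fin using (Fin; _<_)
open import Data.Fin.Properties using (_<?_)
open import Data.Rational using (ℚ; 0ℚ; 1ℚ; _+_; _-_; _*_; _≤_)
open import Data.Product using (Σ; _×_; ∃-syntax)
open import Data.Sum using (_⊎_)
open import Relation.Binary.PropositionalEquality using (_≡_; _≢_)
open import Relation.Nullary using (¬_; yes; no)

-- A 3-subset {i,j,k} of [n], stored in increasing order i < j < k.
record Triple (n : ℕ) : Set where
  constructor triple
  field
    a b c : Fin n
    a<b : a < b
    b<c : b < c

Point : ℕ → Set
Point n = Triple n → ℚ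

-- λ_{xyz} for three (distinct) elements given in any order: the coordinate
-- of the 3-subset {x,y,z}.  (Value 0 if two of them coincide; never used.)
coord : {n : ℕ} → Point n → Fin n → Fin n → Fin n → ℚ
coord λ' x y z with x <? y | y <? z | x <? z
... | yes x<y | yes y<z | _       = λ' (triple x y z x<y y<z)
... | yes x<y | no _    | yes x<z with z <? y
...    | yes z<y = λ' (triple x z y x<z z<y)
...    | no _    = 0ℚ
coord λ' x y z | yes x<y | no _ | no _ with z <? x
...    | yes z<x = λ' (triple z x y z<x x<y)
...    | no _    = 0ℚ
coord λ' x y z | no _ | yes y<z | yes x<z with y <? x
...    | yes y<x = λ' (triple y x z y<x x<z)
...    | no _    = 0ℚ
coord λ' x y z | no _ | yes y<z | no _ with z <? x
...    | yes z<x = λ' (triple y z x y<z z<x)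
...    | no _    = 0ℚ
coord λ' x y z | no _ | no _ | _ with z <? y | y <? x
...    | yes z<y | yes y<x = λ' (triple z y x z<y y<x)
...    | _       | _       = 0ℚ

MinTwice : ℚ → ℚ → ℚ → Set
MinTwice x y z = (x ≡ y × x ≤ z) ⊎ (x ≡ z × x ≤ y) ⊎ (y ≡ z × y ≤ x)

Distinct5 : {n : ℕ} → Fin n → Fin n → Fin n → Fin n → Fin n → Set
Distinct5 h i j k l =
  h ≢ i × h ≢ j × h ≢ k × h ≢ l × i ≢ j × i ≢ k × i ≢ l × j ≢ k × j ≢ l × k ≢ l

InDressian : (n : ℕ) → Point n → Set
InDressian n λ' = (h i j k l : Fin n) → Distinct5 h i j k l →
  MinTwice (coord λ' h i j + coord λ' h k l)
           (coord λ' h i k + coord λ' h j l)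
           (coord λ' h i l + coord λ' h j k)

sumFin : (m : ℕ) → (Fin m → ℚ) → ℚ
sumFin zero    f = 0ℚ
sumFin (suc m) f = f Data.Fin.zero + sumFin m (λ i → f (Data.Fin.suc i))

AffinelyIndependent : {n : ℕ} (m : ℕ) → (Fin (suc m) → Point n) → Set
AffinelyIndependent m p =
  (c : Fin m → ℚ) →
  ((t : Triple _) → sumFin m (λ i → c i * (p (Data.Fin.suc i) t - p Data.Fin.zero t)) ≡ 0ℚ) →
  (i : Fin m) → c i ≡ 0ℚ

HullInDressian : (n m : ℕ) → (Fin (suc m) → Point n) → Set
HullInDressian n m p =
  (w : Fin (suc m) → ℚ) → ((i : Fin (suc m)) → 0ℚ ≤ w i) →
  sumFin (suc m) w ≡ 1ℚ →
  InDressian n (λ t → sumFin (suc m) (λ i → w i * p i t))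

ContainsSimplex : (n m : ℕ) → Set
ContainsSimplex n m =
  Σ (Fin (suc m) → Point n) λ p → AffinelyIndependent m p × HullInDressian n m p

FanDimension : (n D : ℕ) → Set
FanDimension n D = ContainsSimplex n D × ¬ ContainsSimplex n (suc D)

-- Dimension of Dr(3,n) as a polyhedral complex: factor out the
-- n-dimensional lineality space and intersect with the unit sphere,
-- i.e. d = D - n - 1 where D is the fan dimension.
ComplexDimension : (n d : ℕ) → Set
ComplexDimension n d = FanDimension n (d ℕ.+ n ℕ.+ 1)

{-# OPTIONS --safe #-}

-- Each three-term condition confines a point to a tropical line, a union of
-- three half-planes glued along their common boundary. A convex subset lies in
-- one of these half-planes, so every simplex in the Dressian lies in one of
-- finitely many polyhedral cones, indexed by a choice of leg per condition. The
-- double description method gives generators of these cones and Gaussian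
-- elimination their ranks; the maximal rank is the fan dimension.
--
-- Upper bound: fix h < k and consider a linear combination of the edges of a
-- simplex whose coordinates with maximum below k vanish. By the condition at
-- h | x y z k, among any three coordinates h x k, h y k, h z k two agree. Hence
-- two coordinates per pair (h , k) determine all the others.
--
-- Lower bound: triples of sum n pairwise share at most one element, so every
-- nonnegative vector supported on them lies in the Dressian, and there are
-- quadratically many of them.
module Submission where

open import Defs
open import Data.Nat as ℕ using (ℕ; zero; suc; z≤n; s≤s)
import Data.Nat.Properties as ℕ
open import Data.Nat.Tactic.RingSolver using (solve-∀)
open import Data.Fin as Fin using (Fin; zero; suc; toℕ; fromℕ<; remQuot)
import Data.Fin.Properties as Fin
open import Data.List using (List; []; _∷_; _++_; length; map; filter; allFin; concatMap; cartesianProduct; cartesianProductWith)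
open import Data.List.Properties using (length-++; length-tabulate)
open import Data.List.Membership.Propositional using (_∈_; lose)
open import Data.List.Membership.Propositional.Properties
open import Data.List.Relation.Unary.Any using (here; there; toSum)
open import Data.List.Relation.Unary.All as All using (All; []; _∷_)
open import Data.List.Relation.Unary.All.Properties using (++⁺; ++⁻)
open import Data.Product using (∃; _×_; _,_; proj₁; proj₂; uncurry; ∃-syntax)
open import Data.Sum as Sum using (_⊎_; inj₁; inj₂; [_,_]′)
open import Function using (_∘_; id)
open import Relation.Binary using (DecidableEquality; tri<; tri≈; tri>)
open import Relation.Binary.PropositionalEquality
open import Relation.Nullary using (¬_; Dec; yes; no; contradiction; ¬?; _×-dec_)

-- The obstacle is that `FanDimension` asks for an attained maximum. A simplex of some dimension
-- together with the bound `m ≤ n * (n * 2)` would give one by excluded middle, but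
-- `ContainsSimplex` is not visibly decidable: the vertices range over infinitely many points and
-- the hull condition over all rational weights. A finite list of cones with explicit generators
-- turns the maximum into a computation of ranks. The two quadratic bounds speak only of simplices
-- and locate this maximum afterwards.

module LinearAlgebra where

  open import Data.Rational using (ℚ; 0ℚ; 1ℚ; _+_; _-_; _*_; -_; _≤_; 1/_; ≢-nonZero; nonNegative)
  open import Data.Rational.Properties
  open import Data.Rational.Solver using (module +-*-Solver)

  -- Finite sums of rationals.

  sum-cong : ∀ m {f g : Fin m → ℚ} → (∀ i → f i ≡ g i) → sumFin m f ≡ sumFin m g
  sum-cong zero    _  = refl
  sum-cong (suc m) eq = cong₂ _+_ (eq zero) (sum-cong m (λ i → eq (suc i)))

  sum-0 : ∀ m {f : Fin m → ℚ} → (∀ i → f i ≡ 0ℚ) → sumFin m f ≡ 0ℚ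
  sum-0 zero    _  = refl
  sum-0 (suc m) eq = cong₂ _+_ (eq zero) (sum-0 m (λ i → eq (suc i)))

  sum-lin : ∀ m c (f g : Fin m → ℚ) →
    sumFin m (λ i → c * f i + g i) ≡ c * sumFin m f + sumFin m g
  sum-lin zero    c f g = sym (trans (+-identityʳ (c * 0ℚ)) (*-zeroʳ c))
  sum-lin (suc m) c f g rewrite sum-lin m c (λ i → f (suc i)) (λ i → g (suc i)) =
    solve 5 (λ c f₀ g₀ F G → (c :* f₀ :+ g₀) :+ (c :* F :+ G) := c :* (f₀ :+ F) :+ (g₀ :+ G))
      refl c (f zero) (g zero) _ _
    where open +-*-Solver

  sum-* : ∀ m c (f : Fin m → ℚ) → sumFin m (λ i → c * f i) ≡ c * sumFin m f
  sum-* m c f = begin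
    sumFin m (λ i → c * f i)                     ≡⟨ sum-cong m (λ i → sym (+-identityʳ (c * f i))) ⟩
    sumFin m (λ i → c * f i + 0ℚ)                ≡⟨ sum-lin m c f (λ _ → 0ℚ) ⟩
    c * sumFin m f + sumFin m (λ _ → 0ℚ)         ≡⟨ cong (c * sumFin m f +_) (sum-0 m (λ _ → refl)) ⟩
    c * sumFin m f + 0ℚ                          ≡⟨ +-identityʳ _ ⟩
    c * sumFin m f                               ∎
    where open ≡-Reasoning

  sum-swap : ∀ m n (f : Fin m → Fin n → ℚ) →
    sumFin m (λ i → sumFin n (f i)) ≡ sumFin n (λ j → sumFin m (λ i → f i j))
  sum-swap zero    n f = sym (sum-0 n (λ _ → refl))
  sum-swap (suc m) n f = begin
    sumFin n (f zero) + sumFin m (λ i → sumFin n (f (suc i)))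
      ≡⟨ cong₂ _+_ (sym (*-identityˡ (sumFin n (f zero)))) (sum-swap m n (f ∘ suc)) ⟩
    1ℚ * sumFin n (f zero) + sumFin n (λ j → sumFin m (λ i → f (suc i) j))
      ≡⟨ sum-lin n 1ℚ (f zero) _ ⟨
    sumFin n (λ j → 1ℚ * f zero j + sumFin m (λ i → f (suc i) j))
      ≡⟨ sum-cong n (λ j → cong (_+ sumFin m (λ i → f (suc i) j)) (*-identityˡ (f zero j))) ⟩
    sumFin n (λ j → f zero j + sumFin m (λ i → f (suc i) j)) ∎
    where open ≡-Reasoning

  sum-single : ∀ m {f : Fin m → ℚ} k → (∀ i → i ≢ k → f i ≡ 0ℚ) → sumFin m f ≡ f k
  sum-single (suc m) {f} zero    off =
    trans (cong (f zero +_) (sum-0 m (λ i → off (suc i) λ ()))) (+-identityʳ (f zero))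
  sum-single (suc m) {f} (suc k) off =
    trans (cong₂ _+_ (off zero λ ()) (sum-single m k (λ i i≢k → off (suc i) (i≢k ∘ Fin.suc-injective))))
          (+-identityˡ (f (suc k)))

  +-nonNeg : ∀ {x y} → 0ℚ ≤ x → 0ℚ ≤ y → 0ℚ ≤ x + y
  +-nonNeg = +-mono-≤

  *-nonNeg : ∀ {x y} → 0ℚ ≤ x → 0ℚ ≤ y → 0ℚ ≤ x * y
  *-nonNeg {x} {y} 0≤x 0≤y =
    nonNegative⁻¹ (x * y) {{nonNeg*nonNeg⇒nonNeg x {{nonNegative 0≤x}} y {{nonNegative 0≤y}}}}

  sum-nonNeg : ∀ m {f : Fin m → ℚ} → (∀ i → 0ℚ ≤ f i) → 0ℚ ≤ sumFin m f
  sum-nonNeg zero    _   = ≤-refl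
  sum-nonNeg (suc m) 0≤f = +-nonNeg (0≤f zero) (sum-nonNeg m (λ i → 0≤f (suc i)))

  inverse : ∀ {q} → q ≢ 0ℚ → ∃[ r ] r * q ≡ 1ℚ
  inverse {q} q≢0 = (1/ q) {{≢-nonZero q≢0}} , *-inverseˡ q {{≢-nonZero q≢0}}

  -- Linear combinations and Gaussian elimination.

  comb : {X : Set} (m : ℕ) → (Fin m → ℚ) → (Fin m → X → ℚ) → X → ℚ
  comb m c v x = sumFin m (λ i → c i * v i x)

  Independent : {X : Set} (m : ℕ) → (Fin m → X → ℚ) → Set
  Independent m v = ∀ c → (∀ x → comb m c v x ≡ 0ℚ) → ∀ i → c i ≡ 0ℚ

  -- Restricting the test to a list lets `gauss` bound `m` by the number of coordinates inspected;
  -- the list is an enumeration of `X` in one use and a short list of probes in another.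
  IndependentOn : {X : Set} (xs : List X) (m : ℕ) → (Fin m → X → ℚ) → Set
  IndependentOn xs m v = ∀ c → All (λ x → comb m c v x ≡ 0ℚ) xs → ∀ i → c i ≡ 0ℚ

  DependentOn : {X : Set} (xs : List X) (m : ℕ) → (Fin m → X → ℚ) → Set
  DependentOn xs m v =
    ∃[ c ] (∃[ i ] c i ≢ 0ℚ) × All (λ x → comb m c v x ≡ 0ℚ) xs

  data Remove {X : Set} (x : X) : List X → List X → Set where
    here  : ∀ {xs} → Remove x (x ∷ xs) xs
    there : ∀ {y xs ys} → Remove x xs ys → Remove x (y ∷ xs) (y ∷ ys)

  length-Remove : ∀ {X : Set} {x : X} {xs ys} → Remove x xs ys → length xs ≡ suc (length ys)
  length-Remove here      = refl
  length-Remove (there r) = cong suc (length-Remove r)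

  All-Remove⁺ : ∀ {X : Set} {P : X → Set} {x xs ys} → Remove x xs ys → P x → All P ys → All P xs
  All-Remove⁺ here      px pys        = px ∷ pys
  All-Remove⁺ (there r) px (py ∷ pys) = py ∷ All-Remove⁺ r px pys

  All-Remove⁻ : ∀ {X : Set} {P : X → Set} {x xs ys} → Remove x xs ys → All P xs → P x × All P ys
  All-Remove⁻ here      (px ∷ pys) = px , pys
  All-Remove⁻ (there r) (py ∷ pxs) = let px , pys = All-Remove⁻ r pxs in px , py ∷ pys

  pivot : {X : Set} (u : X → ℚ) (xs : List X) →
    All (λ x → u x ≡ 0ℚ) xs ⊎ ∃[ x ] ∃[ ys ] Remove x xs ys × u x ≢ 0ℚ
  pivot u []       = inj₁ []
  pivot u (x ∷ xs) with u x ≟ 0ℚ | pivot u xs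
  ... | no  ux≢0 | _                       = inj₂ (x , xs , here , ux≢0)
  ... | yes ux≡0 | inj₁ zs                 = inj₁ (ux≡0 ∷ zs)
  ... | yes _    | inj₂ (y , ys , r , uy≢0) = inj₂ (y , x ∷ ys , there r , uy≢0)

  module Eliminate {X : Set} {m} (u : X → ℚ) (v : Fin m → X → ℚ)
                   (x : X) (r : ℚ) (r*ux : r * u x ≡ 1ℚ) where

    w : Fin m → X → ℚ
    w i y = v i y - (r * v i x) * u y

    -- A combination of reduced rows is one of the original rows in which the coefficient of `u` is
    -- forced. Both outcomes of `gauss` are carried back through this equation.
    comb-w : ∀ c y → comb m c w y ≡ (- (r * comb m c v x)) * u y + comb m c v y
    comb-w c y = begin
      sumFin m (λ i → c i * (v i y - (r * v i x) * u y))
        ≡⟨ sum-cong m (λ i → solve 5 (λ c a r b u → c :* (a :- (r :* b) :* u) :=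
             (:- (r :* u)) :* (c :* b) :+ c :* a) refl (c i) (v i y) r (v i x) (u y)) ⟩
      sumFin m (λ i → (- (r * u y)) * (c i * v i x) + c i * v i y)
        ≡⟨ sum-lin m (- (r * u y)) _ _ ⟩
      (- (r * u y)) * comb m c v x + comb m c v y
        ≡⟨ cong (_+ comb m c v y) (solve 3 (λ r u s → (:- (r :* u)) :* s := (:- (r :* s)) :* u)
             refl r (u y) (comb m c v x)) ⟩
      (- (r * comb m c v x)) * u y + comb m c v y ∎
      where open ≡-Reasoning
            open +-*-Solver

    comb-w-pivot : ∀ c → comb m c w x ≡ 0ℚ
    comb-w-pivot c = begin
      comb m c w x                                       ≡⟨ comb-w c x ⟩
      (- (r * s)) * u x + s                              ≡⟨ solve 3 (λ r s u → (:- (r :* s)) :* u :+ s := s :* (con 1ℚ :- r :* u)) refl r s (u x) ⟩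
      s * (1ℚ - r * u x)                                 ≡⟨ cong (λ z → s * (1ℚ - z)) r*ux ⟩
      s * (1ℚ - 1ℚ)                                      ≡⟨ *-zeroʳ s ⟩
      0ℚ                                                 ∎
      where open ≡-Reasoning
            open +-*-Solver
            s = comb m c v x

  -- If the first row vanishes on `xs`, it is itself a relation. Otherwise a pivot removes one row
  -- and one coordinate together, and this pairing of rows with coordinates yields `m ≤ length xs`.
  gauss : {X : Set} (m : ℕ) (v : Fin m → X → ℚ) (xs : List X) →
    DependentOn xs m v ⊎ (IndependentOn xs m v × m ℕ.≤ length xs)
  gauss zero    v xs = inj₂ ((λ _ _ ()) , z≤n)
  gauss {X} (suc m) v xs with pivot (v zero) xs
  ... | inj₁ v₀≡0 = inj₁ (e₀ , (zero , λ ()) , All.map relation v₀≡0)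
    where
    e₀ : Fin (suc m) → ℚ
    e₀ zero    = 1ℚ
    e₀ (suc _) = 0ℚ
    relation : ∀ {x} → v zero x ≡ 0ℚ → comb (suc m) e₀ v x ≡ 0ℚ
    relation {x} v₀x≡0 = cong₂ _+_ (trans (*-identityˡ (v zero x)) v₀x≡0)
                                   (sum-0 m (λ i → *-zeroˡ (v (suc i) x)))
  ... | inj₂ (x , ys , x∉ys , v₀x≢0) = lift (gauss m w ys)
    where
    r = proj₁ (inverse v₀x≢0)
    open Eliminate (v zero) (v ∘ suc) x r (proj₂ (inverse v₀x≢0))
    lift : DependentOn ys m w ⊎ (IndependentOn ys m w × m ℕ.≤ length ys) →
           DependentOn xs (suc m) v ⊎ (IndependentOn xs (suc m) v × suc m ℕ.≤ length xs)
    lift (inj₁ (d , (i , di≢0) , rel)) =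
      inj₁ (c , (suc i , di≢0) ,
            All-Remove⁺ x∉ys (trans (sym (comb-w d x)) (comb-w-pivot d))
                             (All.map (λ {y} → trans (sym (comb-w d y))) rel))
      where
      c : Fin (suc m) → ℚ
      c zero    = - (r * comb m d (v ∘ suc) x)
      c (suc i) = d i
    lift (inj₂ (ind , m≤)) =
      inj₂ (ind′ , subst (suc m ℕ.≤_) (sym (length-Remove x∉ys)) (s≤s m≤))
      where
      ind′ : IndependentOn xs (suc m) v
      ind′ c rel = λ { zero → c₀≡0 ; (suc i) → c′≡0 i }
        where
        open ≡-Reasoning
        open +-*-Solver
        c′ = c ∘ suc
        s  = comb m c′ (v ∘ suc) x
        atx : c zero * v zero x + s ≡ 0ℚ
        atx = proj₁ (All-Remove⁻ x∉ys rel)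
        -- The relation at the pivot forces the coefficient of `v zero`; with this value `comb-w`
        -- turns a relation for `v` into one for `w`.
        c₀ : c zero ≡ - (r * s)
        c₀ = begin
          c zero                                             ≡⟨ *-identityʳ (c zero) ⟨
          c zero * 1ℚ                                        ≡⟨ cong (c zero *_) (proj₂ (inverse v₀x≢0)) ⟨
          c zero * (r * v zero x)                            ≡⟨ solve 4 (λ c r u s → c :* (r :* u) := r :* (c :* u :+ s) :- r :* s) refl (c zero) r (v zero x) s ⟩
          r * (c zero * v zero x + s) - r * s                ≡⟨ cong (λ z → r * z - r * s) atx ⟩
          r * 0ℚ - r * s                                     ≡⟨ solve 2 (λ r s → r :* con 0ℚ :- r :* s := :- (r :* s)) refl r s ⟩
          - (r * s)                                          ∎
        c′≡0 : ∀ i → c′ i ≡ 0ℚ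
        c′≡0 = ind c′ (All.map (λ {y} e → begin
          comb m c′ w y                                        ≡⟨ comb-w c′ y ⟩
          (- (r * s)) * v zero y + comb m c′ (v ∘ suc) y       ≡⟨ cong (λ z → z * v zero y + comb m c′ (v ∘ suc) y) c₀ ⟨
          c zero * v zero y + comb m c′ (v ∘ suc) y            ≡⟨ e ⟩
          0ℚ                                                   ∎)
          (proj₂ (All-Remove⁻ x∉ys rel)))
        c₀≡0 : c zero ≡ 0ℚ
        c₀≡0 = begin
          c zero     ≡⟨ c₀ ⟩
          - (r * s)  ≡⟨ cong (λ z → - (r * z)) (sum-0 m (λ i → trans (cong (_* v (suc i) x) (c′≡0 i)) (*-zeroˡ (v (suc i) x)))) ⟩
          - (r * 0ℚ) ≡⟨ cong -_ (*-zeroʳ r) ⟩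
          0ℚ         ∎

  -- Spans and bases.

  Span : {X : Set} (r : ℕ) → (Fin r → X → ℚ) → (X → ℚ) → Set
  Span r b g = ∃[ c ] (∀ x → g x ≡ comb r c b x)

  span-0 : ∀ {X : Set} {r} {b : Fin r → X → ℚ} {g : X → ℚ} → (∀ x → g x ≡ 0ℚ) → Span r b g
  span-0 {r = r} {b} g≡0 = (λ _ → 0ℚ) , λ x → trans (g≡0 x) (sym (sum-0 r (λ i → *-zeroˡ (b i x))))

  span-lin : ∀ {X : Set} {r} {b : Fin r → X → ℚ} {g h k : X → ℚ} a →
    Span r b g → Span r b h → (∀ x → k x ≡ a * g x + h x) → Span r b k
  span-lin {r = r} {b} {g} {h} {k} a (c , eg) (d , eh) ek = (λ i → a * c i + d i) , λ x → begin
    k x                                            ≡⟨ ek x ⟩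
    a * g x + h x                                  ≡⟨ cong₂ (λ y z → a * y + z) (eg x) (eh x) ⟩
    a * comb r c b x + comb r d b x                ≡⟨ sum-lin r a _ _ ⟨
    sumFin r (λ i → a * (c i * b i x) + d i * b i x)
      ≡⟨ sum-cong r (λ i → solve 4 (λ a c d b → a :* (c :* b) :+ d :* b := (a :* c :+ d) :* b) refl a (c i) (d i) (b i x)) ⟩
    comb r (λ i → a * c i + d i) b x ∎
    where open ≡-Reasoning
          open +-*-Solver

  -- Elimination runs on the coefficient rows of the `u i`: a relation among these rows is one among
  -- the `u i`, so independence leaves only the outcome with the bound.
  steinitz : ∀ {X : Set} {r m} {b : Fin r → X → ℚ} {u : Fin m → X → ℚ} →
    (∀ i → Span r b (u i)) → Independent m u → m ℕ.≤ r
  steinitz {r = r} {m} {b} {u} spans ind with gauss m (λ i → proj₁ (spans i)) (allFin r)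
  ... | inj₂ (_ , m≤) = subst (m ℕ.≤_) (length-tabulate (λ i → i)) m≤
  ... | inj₁ (d , (i , di≢0) , rel) = contradiction (ind d vanish i) di≢0
    where
    open ≡-Reasoning
    A = λ i → proj₁ (spans i)
    vanish : ∀ x → comb m d u x ≡ 0ℚ
    vanish x = begin
      sumFin m (λ i → d i * u i x)
        ≡⟨ sum-cong m (λ i → trans (cong (d i *_) (proj₂ (spans i) x)) (sym (sum-* r (d i) _))) ⟩
      sumFin m (λ i → sumFin r (λ j → d i * (A i j * b j x)))
        ≡⟨ sum-swap m r _ ⟩
      sumFin r (λ j → sumFin m (λ i → d i * (A i j * b j x)))
        ≡⟨ sum-0 r (λ j → begin
             sumFin m (λ i → d i * (A i j * b j x))
               ≡⟨ sum-cong m (λ i → trans (sym (*-assoc (d i) _ _)) (*-comm _ (b j x))) ⟩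
             sumFin m (λ i → b j x * (d i * A i j))
               ≡⟨ sum-* m (b j x) _ ⟩
             b j x * comb m d A j
               ≡⟨ cong (b j x *_) (All.lookup rel (∈-allFin j)) ⟩
             b j x * 0ℚ
               ≡⟨ *-zeroʳ (b j x) ⟩
             0ℚ ∎) ⟩
      0ℚ ∎

  -- The vectors are taken from `G` itself: when `G` generates a cone they must lie in that cone, to
  -- serve as vertices of a simplex.
  record Basis {X : Set} (G : List (X → ℚ)) : Set where
    field
      rank        : ℕ
      vec         : Fin rank → X → ℚ
      vec∈        : ∀ i → vec i ∈ G
      independent : Independent rank vec
      spanning    : ∀ {g} → g ∈ G → Span rank vec g

  cons : ∀ {A : Set} {m} → A → (Fin m → A) → Fin (suc m) → A
  cons x f zero    = x
  cons x f (suc i) = f i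

  basis : {X : Set} (xs : List X) → (∀ x → x ∈ xs) → (G : List (X → ℚ)) → Basis G
  basis xs _ [] = record
    { rank = 0 ; vec = λ () ; vec∈ = λ () ; independent = λ _ _ () ; spanning = λ () }
  basis xs complete (g ∷ G) with basis xs complete G
  ... | B with gauss (suc (Basis.rank B)) (cons g (Basis.vec B)) xs
  ...   | inj₂ (ind , _) = record
    { rank        = suc rank
    ; vec         = cons g vec
    ; vec∈        = λ { zero → here refl ; (suc i) → there (vec∈ i) }
    ; independent = λ c rel → ind c (All.tabulate (λ {x} _ → rel x))
    ; spanning    = λ { (here refl) → cons 1ℚ (λ _ → 0ℚ) , λ x → sym (trans
                          (cong₂ _+_ (*-identityˡ (g x)) (sum-0 rank (λ i → *-zeroˡ (vec i x)))) (+-identityʳ (g x)))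
                      ; (there h∈G) → let c , eq = spanning h∈G in
                          cons 0ℚ c , λ x → trans (eq x) (sym (trans
                            (cong (_+ comb rank c vec x) (*-zeroˡ (g x))) (+-identityˡ _))) }
    }
    where open Basis B
  ...   | inj₁ (c , (i , ci≢0) , rel) = record
    { rank        = rank
    ; vec         = vec
    ; vec∈        = λ i → there (vec∈ i)
    ; independent = independent
    ; spanning    = λ { (here refl) → span-g ; (there h∈G) → spanning h∈G }
    }
    where
    open Basis B
    open ≡-Reasoning
    open +-*-Solver
    c′ : Fin rank → ℚ
    c′ i = c (suc i)
    at : ∀ x → c zero * g x + comb rank c′ vec x ≡ 0ℚ
    at x = All.lookup rel (complete x)
    -- A nontrivial relation must involve `g`, as it would otherwise be one among the independent
    -- `vec`; hence it can be solved for `g`.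
    nonzero : ∀ i → c i ≢ 0ℚ → c zero ≢ 0ℚ
    nonzero zero    c₀≢0 = c₀≢0
    nonzero (suc i) ci≢0 c₀≡0 = ci≢0 (independent c′ (λ x → begin
      comb rank c′ vec x                  ≡⟨ +-identityˡ _ ⟨
      0ℚ + comb rank c′ vec x             ≡⟨ cong (_+ comb rank c′ vec x) (*-zeroˡ (g x)) ⟨
      0ℚ * g x + comb rank c′ vec x       ≡⟨ cong (λ z → z * g x + comb rank c′ vec x) c₀≡0 ⟨
      c zero * g x + comb rank c′ vec x   ≡⟨ at x ⟩
      0ℚ                                  ∎) i)
    r = proj₁ (inverse (nonzero i ci≢0))
    span-g : Span rank vec g
    span-g = (λ i → - r * c′ i) , λ x → let s = comb rank c′ vec x in begin
      g x                                   ≡⟨ *-identityˡ (g x) ⟨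
      1ℚ * g x                              ≡⟨ cong (_* g x) (proj₂ (inverse (nonzero i ci≢0))) ⟨
      r * c zero * g x                      ≡⟨ solve 4 (λ r c g s → r :* c :* g := r :* (c :* g :+ s) :+ (:- r) :* s) refl r (c zero) (g x) s ⟩
      r * (c zero * g x + s) + - r * s      ≡⟨ cong (λ z → r * z + - r * s) (at x) ⟩
      r * 0ℚ + - r * s                      ≡⟨ trans (cong (_+ - r * s) (*-zeroʳ r)) (+-identityˡ _) ⟩
      - r * s                               ≡⟨ sum-* rank (- r) _ ⟨
      sumFin rank (λ i → - r * (c′ i * vec i x)) ≡⟨ sum-cong rank (λ i → sym (*-assoc (- r) (c′ i) (vec i x))) ⟩
      comb rank (λ i → - r * c′ i) vec x    ∎

-- Polyhedral cones and their generators.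

module Cones where

  open LinearAlgebra
  open import Data.Rational using (ℚ; 0ℚ; 1ℚ; _+_; _-_; _*_; -_; _≤_; _<_; positive; Positive)
  open import Data.Rational.Properties
  open import Data.Rational.Solver using (module +-*-Solver)

  p≤q⇒0≤q-p : ∀ {p q} → p ≤ q → 0ℚ ≤ q - p
  p≤q⇒0≤q-p {p} {q} p≤q = subst (_≤ q - p) (+-inverseʳ p) (+-monoˡ-≤ (- p) p≤q)

  0≤q-p⇒p≤q : ∀ {p q} → 0ℚ ≤ q - p → p ≤ q
  0≤q-p⇒p≤q {p} {q} 0≤q-p =
    subst₂ _≤_ (+-identityˡ p) (solve 2 (λ p q → (q :- p) :+ p := q) refl p q) (+-monoˡ-≤ p 0≤q-p)
    where open +-*-Solver

  -- `ext` is a field because, without function extensionality, pointwise equal points need not be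
  -- propositionally equal.
  record Functional (X : Set) : Set where
    field
      fun  : (X → ℚ) → ℚ
      ext  : ∀ {u v} → (∀ x → u x ≡ v x) → fun u ≡ fun v
      lin  : ∀ c u v → fun (λ x → c * u x + v x) ≡ c * fun u + fun v

    fun-0 : ∀ {u} → (∀ x → u x ≡ 0ℚ) → fun u ≡ 0ℚ
    fun-0 {u} u≡0 = begin
      fun u                              ≡⟨ ext (λ x → trans (u≡0 x) (sym (cong (λ z → - 1ℚ * z + z) (u≡0 x)))) ⟩
      fun (λ x → - 1ℚ * u x + u x)       ≡⟨ lin (- 1ℚ) u u ⟩
      - 1ℚ * fun u + fun u               ≡⟨ solve 1 (λ z → :- con 1ℚ :* z :+ z := con 0ℚ) refl (fun u) ⟩
      0ℚ                                 ∎
      where open ≡-Reasoning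
            open +-*-Solver

    fun-+ : ∀ u v → fun (λ x → u x + v x) ≡ fun u + fun v
    fun-+ u v = begin
      fun (λ x → u x + v x)           ≡⟨ ext (λ x → cong (_+ v x) (sym (*-identityˡ (u x)))) ⟩
      fun (λ x → 1ℚ * u x + v x)      ≡⟨ lin 1ℚ u v ⟩
      1ℚ * fun u + fun v              ≡⟨ cong (_+ fun v) (*-identityˡ (fun u)) ⟩
      fun u + fun v                   ∎
      where open ≡-Reasoning

    fun-comb : ∀ m c (v : Fin m → X → ℚ) → fun (comb m c v) ≡ sumFin m (λ i → c i * fun (v i))
    fun-comb zero    c v = fun-0 (λ _ → refl)
    fun-comb (suc m) c v = trans (lin (c zero) (v zero) (comb m (c ∘ suc) (v ∘ suc)))
                                 (cong (c zero * fun (v zero) +_) (fun-comb m (c ∘ suc) (v ∘ suc)))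

  open Functional public

  infixl 6 _⊕_ _⊖_

  _⊕_ : ∀ {X} → Functional X → Functional X → Functional X
  (f ⊕ g) .fun u     = fun f u + fun g u
  (f ⊕ g) .ext u≗v   = cong₂ _+_ (ext f u≗v) (ext g u≗v)
  (f ⊕ g) .lin c u v = trans (cong₂ _+_ (lin f c u v) (lin g c u v))
    (solve 5 (λ c fu fv gu gv → (c :* fu :+ fv) :+ (c :* gu :+ gv) := c :* (fu :+ gu) :+ (fv :+ gv))
      refl c (fun f u) (fun f v) (fun g u) (fun g v))
    where open +-*-Solver

  _⊖_ : ∀ {X} → Functional X → Functional X → Functional X
  (f ⊖ g) .fun u     = fun f u - fun g u
  (f ⊖ g) .ext u≗v   = cong₂ _-_ (ext f u≗v) (ext g u≗v)
  (f ⊖ g) .lin c u v = trans (cong₂ _-_ (lin f c u v) (lin g c u v))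
    (solve 5 (λ c fu fv gu gv → (c :* fu :+ fv) :- (c :* gu :+ gv) := c :* (fu :- gu) :+ (fv :- gv))
      refl c (fun f u) (fun f v) (fun g u) (fun g v))
    where open +-*-Solver

  Sat : {X : Set} → List (Functional X) → (X → ℚ) → Set
  Sat fs u = All (λ f → 0ℚ ≤ fun f u) fs

  sat-comb : ∀ {X fs m c} {v : Fin m → X → ℚ} →
    (∀ i → 0ℚ ≤ c i) → (∀ i → Sat fs (v i)) → Sat fs (comb m c v)
  sat-comb {fs = fs} {m} {c} {v} 0≤c sat = All.tabulate λ {f} f∈fs →
    subst (0ℚ ≤_) (sym (fun-comb f m c v)) (sum-nonNeg m (λ i → *-nonNeg (0≤c i) (All.lookup (sat i) f∈fs)))

  -- Every layer carries a pointwise equation, again for want of extensionality. Generators are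
  -- given by a predicate so that a family can be split according to the sign of a functional.
  data Cone {X : Set} (P : (X → ℚ) → Set) (u : X → ℚ) : Set where
    nil : (∀ x → u x ≡ 0ℚ) → Cone P u
    add : ∀ {g c v} → P g → 0ℚ ≤ c → Cone P v → (∀ x → u x ≡ c * g x + v x) → Cone P u

  module _ {X : Set} where

    cone-mono : ∀ {P Q : (X → ℚ) → Set} {u} → (∀ {g} → P g → Q g) → Cone P u → Cone Q u
    cone-mono sub (nil e)         = nil e
    cone-mono sub (add p 0≤c K e) = add (sub p) 0≤c (cone-mono sub K) e

    cone-ext : ∀ {P : (X → ℚ) → Set} {u v} → (∀ x → u x ≡ v x) → Cone P v → Cone P u
    cone-ext u≗v (nil e)         = nil (λ x → trans (u≗v x) (e x))
    cone-ext u≗v (add p 0≤c K e) = add p 0≤c K (λ x → trans (u≗v x) (e x))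

    cone-+ : ∀ {P : (X → ℚ) → Set} {u v w} → Cone P u → Cone P v → (∀ x → w x ≡ u x + v x) → Cone P w
    cone-+ {v = v} (nil e) L ew =
      cone-ext (λ x → trans (ew x) (trans (cong (_+ v x) (e x)) (+-identityˡ (v x)))) L
    cone-+ {v = v} (add {g} {c} {u′} p 0≤c K e) L ew =
      add p 0≤c (cone-+ K L (λ _ → refl))
        (λ x → trans (ew x) (trans (cong (_+ v x) (e x)) (+-assoc (c * g x) (u′ x) (v x))))

    cone-span : ∀ {P : (X → ℚ) → Set} {u r} {b : Fin r → X → ℚ} →
      (∀ {g} → P g → Span r b g) → Cone P u → Span r b u
    cone-span spans (nil e)                     = span-0 e
    cone-span spans (add {c = c} p 0≤c K e) = span-lin c (spans p) (cone-span spans K) e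

    cone-zero : ∀ {P : (X → ℚ) → Set} {u} (f : Functional X) →
      (∀ {g} → P g → fun f g ≡ 0ℚ) → Cone P u → fun f u ≡ 0ℚ
    cone-zero f z (nil e) = fun-0 f e
    cone-zero {u = u} f z (add {g} {c} {v} p 0≤c K e) = begin
      fun f u                       ≡⟨ ext f e ⟩
      fun f (λ x → c * g x + v x)   ≡⟨ lin f c g v ⟩
      c * fun f g + fun f v         ≡⟨ cong₂ (λ a b → c * a + b) (z p) (cone-zero f z K) ⟩
      c * 0ℚ + 0ℚ                   ≡⟨ trans (+-identityʳ _) (*-zeroʳ c) ⟩
      0ℚ                            ∎
      where open ≡-Reasoning

    cone-negative : ∀ {P : (X → ℚ) → Set} {u} (f : Functional X) →
      (∀ {g} → P g → fun f g < 0ℚ) → Cone P u → fun f u ≤ 0ℚ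
    cone-negative f neg (nil e) = ≤-reflexive (fun-0 f e)
    cone-negative f neg (add {g} {c} {v} p 0≤c K e) = subst (_≤ 0ℚ)
      (sym (trans (ext f e) (lin f c g v)))
      (+-mono-≤ {c * fun f g} {0ℚ} {fun f v} {0ℚ} (0≤q-p⇒p≤q (subst (0ℚ ≤_)
          (solve 2 (λ c a → c :* (con 0ℚ :- a) := con 0ℚ :- c :* a) refl c (fun f g))
          (*-nonNeg 0≤c (p≤q⇒0≤q-p (<⇒≤ (neg p))))))
        (cone-negative f neg K))
      where open +-*-Solver

    -- In `c * fun f g + fun f v` both terms are at most 0, so a nonnegative total makes both
    -- vanish. As `fun f g` is strictly negative, `c` is 0, and the recursion treats `v`.
    cone-negative-zero : ∀ {P : (X → ℚ) → Set} {u} (f : Functional X) →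
      (∀ {g} → P g → fun f g < 0ℚ) → Cone P u → 0ℚ ≤ fun f u → ∀ x → u x ≡ 0ℚ
    cone-negative-zero f neg (nil e) _ = e
    cone-negative-zero {u = u} f neg (add {g} {c} {v} p 0≤c K e) 0≤fu x = begin
      u x                 ≡⟨ e x ⟩
      c * g x + v x       ≡⟨ cong₂ (λ a b → a * g x + b) c≡0 (cone-negative-zero f neg K 0≤fv x) ⟩
      0ℚ * g x + 0ℚ       ≡⟨ trans (+-identityʳ (0ℚ * g x)) (*-zeroˡ (g x)) ⟩
      0ℚ                  ∎
      where
      open ≡-Reasoning
      module S = +-*-Solver
      total : 0ℚ ≤ c * fun f g + fun f v
      total = subst (0ℚ ≤_) (trans (ext f e) (lin f c g v)) 0≤fu
      0≤b : 0ℚ ≤ - fun f g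
      0≤b = neg-antimono-≤ (<⇒≤ (neg p))
      0≤fv : 0ℚ ≤ fun f v
      0≤fv = subst (0ℚ ≤_) (S.solve 3 (λ c a v → (c S.:* a S.:+ v) S.:+ c S.:* (S.:- a) S.:= v) refl c (fun f g) (fun f v))
               (+-nonNeg total (*-nonNeg 0≤c 0≤b))
      c≤0 : c ≤ 0ℚ
      c≤0 = *-cancelʳ-≤-pos (- fun f g) {{positive (neg-antimono-< (neg p))}} (0≤q-p⇒p≤q
        (subst (0ℚ ≤_) (S.solve 3 (λ c a v → (c S.:* a S.:+ v) S.:+ (S.con 0ℚ S.:- v) S.:= S.con 0ℚ S.:* (S.:- a) S.:- c S.:* (S.:- a)) refl c (fun f g) (fun f v))
          (+-nonNeg total (p≤q⇒0≤q-p (cone-negative f neg K)))))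
      c≡0 : c ≡ 0ℚ
      c≡0 = ≤-antisym c≤0 0≤c

  positive-inverse : ∀ {q} → 0ℚ < q → ∃[ r ] 0ℚ ≤ r × r * q ≡ 1ℚ
  positive-inverse {q} 0<q = r , 0≤r , r*q
    where
    q≢0 : q ≢ 0ℚ
    q≢0 q≡0 = <-irrefl (sym q≡0) 0<q
    r   = proj₁ (inverse q≢0)
    r*q = proj₂ (inverse q≢0)
    instance
      q>0 : Positive q
      q>0 = positive 0<q
    0≤r : 0ℚ ≤ r
    0≤r = *-cancelʳ-≤-pos q (subst₂ _≤_ (sym (*-zeroˡ q)) (sym r*q) (<⇒≤ (positive⁻¹ 1ℚ)))

  -- Here `i` is the inverse of `α`. The term `d * h` is traded for a multiple of `α * h + β * g`,
  -- and the `g` used for it is charged to the coefficient `c`.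
  exchange : ∀ c g d h i α β y → i * α ≡ 1ℚ →
    c * g + (d * h + y) ≡ d * i * (α * h + β * g) + ((c - i * (d * β)) * g + y)
  exchange c g d h i α β y iα≡1 = begin
    c * g + (d * h + y)                            
      ≡⟨ solve 4 (λ c g e y → c :* g :+ (e :+ y) := c :* g :+ (con 1ℚ :* e :+ y)) refl c g (d * h) y ⟩
    c * g + (1ℚ * (d * h) + y)                     ≡⟨ cong (λ t → c * g + (t * (d * h) + y)) iα≡1 ⟨
    c * g + (i * α * (d * h) + y)
      ≡⟨ solve 5 (λ c g p q y → c :* g :+ (q :+ y) := (q :+ p :* g) :+ ((c :- p) :* g :+ y)) refl c g (i * (d * β)) (i * α * (d * h)) y ⟩
    (i * α * (d * h) + i * (d * β) * g) + ((c - i * (d * β)) * g + y)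
      ≡⟨ cong (_+ ((c - i * (d * β)) * g + y)) (trans
           (cong (_+ i * (d * β) * g) (solve 4 (λ i α d h → i :* α :* (d :* h) := d :* i :* (α :* h)) refl i α d h))
           (solve 5 (λ i d β g a → d :* i :* a :+ i :* (d :* β) :* g := d :* i :* (a :+ β :* g)) refl i d β g (α * h))) ⟩
    d * i * (α * h + β * g) + ((c - i * (d * β)) * g + y) ∎
    where open ≡-Reasoning
          open +-*-Solver

  remainder : ∀ c d i {a b} → i * b ≡ 1ℚ → 0ℚ ≤ i → c * a ≤ d * b → 0ℚ ≤ d - i * (c * a)
  remainder c d i {a} {b} ib≡1 0≤i ca≤db = subst (0ℚ ≤_) (begin
    i * (d * b - c * a)        ≡⟨ solve 4 (λ i d b e → i :* (d :* b :- e) := d :* (i :* b) :- i :* e) refl i d b (c * a) ⟩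
    d * (i * b) - i * (c * a)  ≡⟨ cong (λ t → d * t - i * (c * a)) ib≡1 ⟩
    d * 1ℚ - i * (c * a)       ≡⟨ cong (_- i * (c * a)) (*-identityʳ d) ⟩
    d - i * (c * a)            ∎) (*-nonNeg 0≤i (p≤q⇒0≤q-p ca≤db))
    where open ≡-Reasoning
          open +-*-Solver

  +-rotate : ∀ a b c → a + (b + c) ≡ b + (a + c)
  +-rotate = solve 3 (λ a b c → a :+ (b :+ c) := b :+ (a :+ c)) refl
    where open +-*-Solver

  -- Double description: cutting by f ≥ 0 keeps the generators with f ≥ 0 and adds,
  -- for each pair of opposite signs, the combination on which f vanishes.
  module HalfSpace {X : Set} (G : List (X → ℚ)) (f : Functional X) where

    join : (X → ℚ) → (X → ℚ) → X → ℚ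
    join g h x = fun f g * h x + (- fun f h) * g x

    fun-join : ∀ (k : Functional X) g h → fun k (join g h) ≡ fun f g * fun k h + (- fun f h) * fun k g
    fun-join k g h = begin
      fun k (λ x → fun f g * h x + (- fun f h) * g x)
        ≡⟨ lin k (fun f g) h (λ x → (- fun f h) * g x) ⟩
      fun f g * fun k h + fun k (λ x → (- fun f h) * g x)
        ≡⟨ cong (fun f g * fun k h +_) (ext k (λ x → sym (+-identityʳ ((- fun f h) * g x)))) ⟩
      fun f g * fun k h + fun k (λ x → (- fun f h) * g x + 0ℚ)
        ≡⟨ cong (fun f g * fun k h +_) (trans (lin k (- fun f h) g (λ _ → 0ℚ))
             (trans (cong ((- fun f h) * fun k g +_) (fun-0 k (λ _ → refl))) (+-identityʳ _))) ⟩
      fun f g * fun k h + (- fun f h) * fun k g ∎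
      where open ≡-Reasoning

    -- Both sign tests are weak: a join has nonnegative coefficients even if `f` vanishes on one of
    -- its generators, so it stays in the old cone.
    nonneg nonpos cut : List (X → ℚ)
    nonneg = filter (λ g → 0ℚ ≤? fun f g) G
    nonpos = filter (λ g → fun f g ≤? 0ℚ) G
    cut    = nonneg ++ cartesianProductWith join nonneg nonpos

    sat-cut : ∀ {fs} → (∀ {g} → g ∈ G → Sat fs g) → ∀ {g} → g ∈ cut → Sat (f ∷ fs) g
    sat-cut {fs} sat {k} k∈ with ∈-++⁻ nonneg k∈
    ... | inj₁ k∈₁ = let k∈G , 0≤fk = ∈-filter⁻ (λ g → 0ℚ ≤? fun f g) {xs = G} k∈₁ in 0≤fk ∷ sat k∈G
    ... | inj₂ k∈₂ with ∈-cartesianProductWith⁻ join nonneg nonpos k∈₂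
    ...   | g , h , g∈ , h∈ , refl =
      subst (0ℚ ≤_) (sym (trans (fun-join f g h)
        (solve 2 (λ a b → a :* b :+ (:- b) :* a := con 0ℚ) refl (fun f g) (fun f h)))) ≤-refl
      ∷ All.tabulate (λ {φ} φ∈ → subst (0ℚ ≤_) (sym (fun-join φ g h))
          (+-nonNeg (*-nonNeg 0≤fg (All.lookup (sat h∈G) φ∈))
                    (*-nonNeg (neg-antimono-≤ fh≤0) (All.lookup (sat g∈G) φ∈))))
      where
      open +-*-Solver
      g∈G  = proj₁ (∈-filter⁻ (λ g → 0ℚ ≤? fun f g) {xs = G} g∈)
      0≤fg = proj₂ (∈-filter⁻ (λ g → 0ℚ ≤? fun f g) {xs = G} g∈)
      h∈G  = proj₁ (∈-filter⁻ (λ g → fun f g ≤? 0ℚ) {xs = G} h∈)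
      fh≤0 = proj₂ (∈-filter⁻ (λ g → fun f g ≤? 0ℚ) {xs = G} h∈)

    Pos Neg Zer : (X → ℚ) → Set
    Pos g = g ∈ G × 0ℚ < fun f g
    Neg g = g ∈ G × fun f g < 0ℚ
    Zer g = g ∈ cut × fun f g ≡ 0ℚ

    join-Zer : ∀ {g h} → Pos g → Neg h → Zer (join g h)
    join-Zer {g} {h} (g∈ , 0<fg) (h∈ , fh<0) =
      ∈-++⁺ʳ nonneg (∈-cartesianProductWith⁺ join (∈-filter⁺ (λ g → 0ℚ ≤? fun f g) g∈ (<⇒≤ 0<fg)) (∈-filter⁺ (λ g → fun f g ≤? 0ℚ) h∈ (<⇒≤ fh<0))) ,
      trans (fun-join f g h) (solve 2 (λ a b → a :* b :+ (:- b) :* a := con 0ℚ) refl (fun f g) (fun f h))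
      where open +-*-Solver

    -- The outcome of cancelling opposite signs: a part on the hyperplane and a rest in which only
    -- one sign survives.
    record Residue (u : X → ℚ) : Set where
      constructor residue
      field
        {z r}  : X → ℚ
        z∈     : Cone Zer z
        r∈     : Cone Pos r ⊎ Cone Neg r
        u≗z+r  : ∀ x → u x ≡ z x + r x

    -- The contributions `c * α` and `d * β` to `f` have opposite signs. If `d * β` is the smaller,
    -- the term in `h` is absorbed into a join and `g` goes on with a reduced coefficient; otherwise
    -- `g` is used up and the negative rest is returned.
    cancel : ∀ {g c r u} → Pos g → 0ℚ ≤ c → Cone Neg r → (∀ x → u x ≡ c * g x + r x) → Residue u
    cancel pg 0≤c (nil r≡0) eu =
      residue (nil (λ _ → refl)) (inj₁ (add pg 0≤c (nil r≡0) (λ _ → refl)))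
        (λ x → trans (eu x) (sym (+-identityˡ _)))
    cancel {g} {c} {r} {u} pg 0≤c (add {h} {d} {y} nh 0≤d K er) eu = compare (≤-total (d * β) (c * α))
      where
      open ≡-Reasoning
      α β : ℚ
      α = fun f g
      β = - fun f h
      0<β : 0ℚ < β
      0<β = neg-antimono-< (proj₂ nh)
      eu′ : ∀ x → u x ≡ c * g x + (d * h x + y x)
      eu′ x = trans (eu x) (cong (c * g x +_) (er x))

      consume-h : ∀ i → 0ℚ ≤ i → i * α ≡ 1ℚ → Residue (λ x → (c - i * (d * β)) * g x + y x) → Residue u
      consume-h i 0≤i iα≡1 (residue {z} {s} z∈ s∈ e) =
        residue (add (join-Zer pg nh) (*-nonNeg 0≤d 0≤i) z∈ (λ _ → refl)) s∈ (λ x → begin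
          u x                                                  ≡⟨ eu′ x ⟩
          c * g x + (d * h x + y x)                            ≡⟨ exchange c (g x) d (h x) i α β (y x) iα≡1 ⟩
          d * i * join g h x + ((c - i * (d * β)) * g x + y x) ≡⟨ cong (d * i * join g h x +_) (e x) ⟩
          d * i * join g h x + (z x + s x)                     ≡⟨ +-assoc (d * i * join g h x) (z x) (s x) ⟨
          d * i * join g h x + z x + s x                       ∎)

      consume-g : ∀ i → 0ℚ ≤ i → i * β ≡ 1ℚ → c * α ≤ d * β → Residue u
      consume-g i 0≤i iβ≡1 cα≤dβ =
        residue (add (join-Zer pg nh) (*-nonNeg 0≤c 0≤i) (nil {u = λ _ → 0ℚ} (λ _ → refl)) (λ _ → refl))
                (inj₂ (add nh (remainder c d i iβ≡1 0≤i cα≤dβ) K (λ _ → refl))) (λ x → begin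
          u x                                                  ≡⟨ eu′ x ⟩
          c * g x + (d * h x + y x)                            ≡⟨ +-rotate (c * g x) (d * h x) (y x) ⟩
          d * h x + (c * g x + y x)                            ≡⟨ exchange d (h x) c (g x) i β α (y x) iβ≡1 ⟩
          c * i * (β * g x + α * h x) + rest x                 ≡⟨ cong (λ t → c * i * t + rest x) (+-comm (β * g x) (α * h x)) ⟩
          c * i * join g h x + rest x                          ≡⟨ cong (_+ rest x) (+-identityʳ (c * i * join g h x)) ⟨
          c * i * join g h x + 0ℚ + rest x                     ∎)
        where
        rest : X → ℚ
        rest x = (d - i * (c * α)) * h x + y x

      compare : d * β ≤ c * α ⊎ c * α ≤ d * β → Residue u
      compare (inj₁ dβ≤cα) = let i , 0≤i , iα≡1 = positive-inverse (proj₂ pg) in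
        consume-h i 0≤i iα≡1 (cancel pg (remainder d c i iα≡1 0≤i dβ≤cα) K (λ _ → refl))
      compare (inj₂ cα≤dβ) = let i , 0≤i , iβ≡1 = positive-inverse 0<β in
        consume-g i 0≤i iβ≡1 cα≤dβ

    -- Positive terms are taken one at a time. If the rest left by the others is positive, the new
    -- term just joins it; if it is negative, the new term is cancelled against it.
    merge : ∀ {p q u} → Cone Pos p → Cone Neg q → (∀ x → u x ≡ p x + q x) → Residue u
    merge {p} (nil p≡0) L eu = residue {z = p} (nil p≡0) (inj₂ L) eu
    merge {p} {q} {u} (add {g} {c} {p′} pg 0≤c K ep) L eu with merge K L (λ _ → refl)
    ... | residue {z} {r} z∈ (inj₁ r∈) e =
      residue z∈ (inj₁ (add pg 0≤c r∈ (λ _ → refl))) (λ x → begin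
        u x                          ≡⟨ trans (eu x) (cong (_+ q x) (ep x)) ⟩
        c * g x + p′ x + q x         ≡⟨ +-assoc (c * g x) (p′ x) (q x) ⟩
        c * g x + (p′ x + q x)       ≡⟨ cong (c * g x +_) (e x) ⟩
        c * g x + (z x + r x)        ≡⟨ solve 3 (λ a z r → a :+ (z :+ r) := z :+ (a :+ r)) refl (c * g x) (z x) (r x) ⟩
        z x + (c * g x + r x)        ∎)
      where open ≡-Reasoning
            open +-*-Solver
    ... | residue {z} {r} z∈ (inj₂ r∈) e with cancel pg 0≤c r∈ (λ _ → refl)
    ...   | residue {z′} {r′} z′∈ r′∈ e′ =
      residue (cone-+ z∈ z′∈ (λ _ → refl)) r′∈ (λ x → begin
        u x                          ≡⟨ trans (eu x) (cong (_+ q x) (ep x)) ⟩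
        c * g x + p′ x + q x         ≡⟨ +-assoc (c * g x) (p′ x) (q x) ⟩
        c * g x + (p′ x + q x)       ≡⟨ cong (c * g x +_) (e x) ⟩
        c * g x + (z x + r x)        ≡⟨ solve 3 (λ a z r → a :+ (z :+ r) := z :+ (a :+ r)) refl (c * g x) (z x) (r x) ⟩
        z x + (c * g x + r x)        ≡⟨ cong (z x +_) (e′ x) ⟩
        z x + (z′ x + r′ x)          ≡⟨ +-assoc (z x) (z′ x) (r′ x) ⟨
        z x + z′ x + r′ x            ∎)
      where open ≡-Reasoning
            open +-*-Solver

    record Signed (u : X → ℚ) : Set where
      constructor signed
      field
        {z p q} : X → ℚ
        z∈      : Cone Zer z
        p∈      : Cone Pos p
        q∈      : Cone Neg q
        u≗z+p+q : ∀ x → u x ≡ z x + (p x + q x)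

    split : ∀ {u} → Cone (_∈ G) u → Signed u
    split {u} (nil e) = signed {z = u} (nil e) (nil (λ _ → refl)) (nil (λ _ → refl)) (λ x → sym (+-identityʳ (u x)))
    split {u} (add {g} {c} g∈ 0≤c K e) with split K | <-cmp (fun f g) 0ℚ
    ... | signed {z} {p} {q} z∈ p∈ q∈ e′ | tri< neg _ _ =
      signed z∈ p∈ (add (g∈ , neg) 0≤c q∈ (λ _ → refl)) (λ x → trans (e x) (trans (cong (c * g x +_) (e′ x))
        (solve 4 (λ a z p q → a :+ (z :+ (p :+ q)) := z :+ (p :+ (a :+ q))) refl (c * g x) (z x) (p x) (q x))))
      where open +-*-Solver
    ... | signed {z} {p} {q} z∈ p∈ q∈ e′ | tri> _ _ pos =
      signed z∈ (add (g∈ , pos) 0≤c p∈ (λ _ → refl)) q∈ (λ x → trans (e x) (trans (cong (c * g x +_) (e′ x))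
        (solve 4 (λ a z p q → a :+ (z :+ (p :+ q)) := z :+ ((a :+ p) :+ q)) refl (c * g x) (z x) (p x) (q x))))
      where open +-*-Solver
    ... | signed {z} {p} {q} z∈ p∈ q∈ e′ | tri≈ _ fg≡0 _ =
      signed (add (∈-++⁺ˡ (∈-filter⁺ (λ g → 0ℚ ≤? fun f g) g∈ (≤-reflexive (sym fg≡0))) , fg≡0) 0≤c z∈ (λ _ → refl)) p∈ q∈
        (λ x → trans (e x) (trans (cong (c * g x +_) (e′ x)) (sym (+-assoc (c * g x) (z x) (p x + q x)))))

    -- After all cancellations `u` is a sum of joins, of generators on the hyperplane, and of a rest
    -- `r` with `fun f r ≡ fun f u`. Since this value is nonnegative, a rest of negative generators
    -- is zero.
    cone-cut : ∀ {u} → Cone (_∈ G) u → 0ℚ ≤ fun f u → Cone (_∈ cut) u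
    cone-cut {u} K 0≤fu with split K
    ... | signed {z} z∈ p∈ q∈ e with merge p∈ q∈ (λ _ → refl)
    ...   | residue {z′} {r} z′∈ r∈ e′ = finish r∈
      where
      z″∈ : Cone Zer (λ x → z x + z′ x)
      z″∈ = cone-+ z∈ z′∈ (λ _ → refl)
      eu : ∀ x → u x ≡ (z x + z′ x) + r x
      eu x = trans (e x) (trans (cong (z x +_) (e′ x)) (sym (+-assoc (z x) (z′ x) (r x))))
      fr≡fu : fun f r ≡ fun f u
      fr≡fu = sym (trans (ext f eu) (trans (fun-+ f _ r)
                (trans (cong (_+ fun f r) (cone-zero f proj₂ z″∈)) (+-identityˡ _))))
      finish : Cone Pos r ⊎ Cone Neg r → Cone (_∈ cut) u
      finish (inj₁ r∈) = cone-+ (cone-mono proj₁ z″∈)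
        (cone-mono (λ { (g∈ , 0<fg) → ∈-++⁺ˡ (∈-filter⁺ (λ g → 0ℚ ≤? fun f g) g∈ (<⇒≤ 0<fg)) }) r∈) eu
      finish (inj₂ r∈) = cone-mono proj₁ (cone-ext (λ x → trans (eu x)
        (trans (cong (z x + z′ x +_) (cone-negative-zero f proj₂ r∈ (subst (0ℚ ≤_) (sym fr≡fu) 0≤fu) x))
               (+-identityʳ _))) z″∈)

  module Unit {X : Set} (_≟X_ : DecidableEquality X) where

    unit : X → X → ℚ
    unit x y with x ≟X y
    ... | yes _ = 1ℚ
    ... | no  _ = 0ℚ

    unit-refl : ∀ x → unit x x ≡ 1ℚ
    unit-refl x with x ≟X x
    ... | yes _   = refl
    ... | no  x≢x = contradiction refl x≢x

    unit-≢ : ∀ {x y} → x ≢ y → unit x y ≡ 0ℚ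
    unit-≢ {x} {y} x≢y with x ≟X y
    ... | yes x≡y = contradiction x≡y x≢y
    ... | no  _   = refl

  module Generators {X : Set} (_≟X_ : DecidableEquality X) (xs : List X) (complete : ∀ x → x ∈ xs) where

    open Unit _≟X_

    units : List (X → ℚ)
    units = map unit xs ++ map (λ x y → - unit x y) xs

    -- The coordinate at `y` is cleared with the unit vector of the matching sign, so the support
    -- moves into the tail of `ys`. Both signs occur in `units` because the double description
    -- starts from the whole space.
    supported : ∀ ys {u} → (∀ x → u x ≢ 0ℚ → x ∈ ys) → Cone (_∈ units) u
    supported []       {u} supp = nil zeros
      where
      zeros : ∀ x → u x ≡ 0ℚ
      zeros x with u x ≟ 0ℚ
      ... | yes e = e
      ... | no  n with () ← supp x n
    supported (y ∷ ys) {u} supp = signs (≤-total 0ℚ (u y))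
      where
      open +-*-Solver
      v : X → ℚ
      v x = u x - u y * unit y x
      supp′ : ∀ x → v x ≢ 0ℚ → x ∈ ys
      supp′ x vx≢0 = decide (y ≟X x)
        where
        decide : Dec (y ≡ x) → x ∈ ys
        decide (yes refl) = contradiction (trans (cong (λ e → u x - u x * e) (unit-refl x))
          (solve 1 (λ a → a :- a :* con 1ℚ := con 0ℚ) refl (u x))) vx≢0
        decide (no y≢x) = [ (λ x≡y → contradiction (sym x≡y) y≢x) , id ]′ (toSum (supp x λ ux≡0 →
          vx≢0 (trans (cong (λ e → u x - u y * e) (unit-≢ y≢x))
                 (trans (solve 2 (λ a b → a :- b :* con 0ℚ := a) refl (u x) (u y)) ux≡0))))
      signs : 0ℚ ≤ u y ⊎ u y ≤ 0ℚ → Cone (_∈ units) u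
      signs (inj₁ 0≤uy) = add (∈-++⁺ˡ (∈-map⁺ unit (complete y))) 0≤uy (supported ys supp′)
        (λ x → solve 3 (λ a b e → a := b :* e :+ (a :- b :* e)) refl (u x) (u y) (unit y x))
      signs (inj₂ uy≤0) = add (∈-++⁺ʳ (map unit xs) (∈-map⁺ (λ x y → - unit x y) (complete y)))
        (neg-antimono-≤ uy≤0) (supported ys supp′)
        (λ x → solve 3 (λ a b e → a := (:- b) :* (:- e) :+ (a :- b :* e)) refl (u x) (u y) (unit y x))

    generators : (fs : List (Functional X)) →
      ∃[ G ] (∀ {g} → g ∈ G → Sat fs g) × (∀ {u} → Sat fs u → Cone (_∈ G) u)
    generators []       = units , (λ _ → []) , λ _ → supported xs (λ x _ → complete x)
    generators (f ∷ fs) with generators fs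
    ... | G , sat , cone = cut , sat-cut sat , λ { (0≤fu ∷ su) → cone-cut (cone su) 0≤fu }
      where open HalfSpace G f

-- Coordinates of the Dressian.

module FanDimensions where

  open LinearAlgebra
  open Cones
  open import Data.Rational using (ℚ; 0ℚ; 1ℚ; ½; _+_; _-_; _*_; -_; _≤_; _<_)
  open import Data.Rational.Properties hiding (_<?_)
  open import Data.Rational.Solver using (module +-*-Solver)
  open import Data.Fin.Properties using (_<?_)

  module _ {n : ℕ} where

    open Triple

    weight : Triple n → ℕ
    weight t = toℕ (a t) ℕ.+ toℕ (b t) ℕ.+ toℕ (c t)

    triple-≡ : {s t : Triple n} → a s ≡ a t → b s ≡ b t → c s ≡ c t → s ≡ t
    triple-≡ {triple x y z p q} {triple .x .y .z p′ q′} refl refl refl =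
      cong₂ (triple x y z) (Fin.<-irrelevant p p′) (Fin.<-irrelevant q q′)

    _≟ₜ_ : DecidableEquality (Triple n)
    s ≟ₜ t with a s Fin.≟ a t | b s Fin.≟ b t | c s Fin.≟ c t
    ... | yes p | yes q | yes r = yes (triple-≡ p q r)
    ... | no ¬p | _     | _     = no (¬p ∘ cong a)
    ... | yes _ | no ¬q | _     = no (¬q ∘ cong b)
    ... | yes _ | yes _ | no ¬r = no (¬r ∘ cong c)

    sorted : Fin n × Fin n × Fin n → List (Triple n)
    sorted (x , y , z) with x <? y | y <? z
    ... | yes x<y | yes y<z = triple x y z x<y y<z ∷ []
    ... | _       | _       = []

    ∈-sorted : ∀ t → t ∈ sorted (a t , b t , c t)
    ∈-sorted t with a t <? b t | b t <? c t
    ... | yes _ | yes _ = here (triple-≡ refl refl refl)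
    ... | no ¬p | _     = contradiction (a<b t) ¬p
    ... | yes _ | no ¬q = contradiction (b<c t) ¬q

    triples : List (Triple n)
    triples = concatMap sorted (cartesianProduct (allFin n) (cartesianProduct (allFin n) (allFin n)))

    ∈-triples : ∀ t → t ∈ triples
    ∈-triples t = ∈-concatMap⁺ sorted (lose
      (∈-cartesianProduct⁺ (∈-allFin (a t)) (∈-cartesianProduct⁺ (∈-allFin (b t)) (∈-allFin (c t))))
      (∈-sorted t))

    -- Collects what survives the sorting in `coord`: the sum of the elements serves the packing,
    -- the bound on the largest element serves the induction of the upper bound. The case analysis
    -- of `coord` is thus repeated only once.
    record Index (x y z : Fin n) (value : Point n → ℚ) : Set where
      constructor index
      field
        t        : Triple n
        value≡   : ∀ u → value u ≡ u t
        weight≡  : weight t ≡ toℕ x ℕ.+ toℕ y ℕ.+ toℕ z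
        c<       : ∀ {m} → toℕ x ℕ.< m → toℕ y ℕ.< m → toℕ z ℕ.< m → toℕ (c t) ℕ.< m

    coord-index : ∀ x y z → Index x y z (λ u → coord u x y z) ⊎ (∀ u → coord u x y z ≡ 0ℚ)
    coord-index x y z with x <? y | y <? z | x <? z
    ... | yes x<y | yes y<z | _       = inj₁ (index (triple x y z x<y y<z) (λ _ → refl) refl (λ _ _ p → p))
    ... | yes x<y | no _    | yes x<z with z <? y
    ...    | yes z<y = inj₁ (index (triple x z y x<z z<y) (λ _ → refl) (xzy (toℕ x) (toℕ y) (toℕ z)) (λ _ p _ → p))
      where xzy : ∀ x y z → x ℕ.+ z ℕ.+ y ≡ x ℕ.+ y ℕ.+ z
            xzy = solve-∀
    ...    | no _    = inj₂ (λ _ → refl)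
    coord-index x y z | yes x<y | no _ | no _ with z <? x
    ...    | yes z<x = inj₁ (index (triple z x y z<x x<y) (λ _ → refl) (zxy (toℕ x) (toℕ y) (toℕ z)) (λ _ p _ → p))
      where zxy : ∀ x y z → z ℕ.+ x ℕ.+ y ≡ x ℕ.+ y ℕ.+ z
            zxy = solve-∀
    ...    | no _    = inj₂ (λ _ → refl)
    coord-index x y z | no _ | yes y<z | yes x<z with y <? x
    ...    | yes y<x = inj₁ (index (triple y x z y<x x<z) (λ _ → refl) (yxz (toℕ x) (toℕ y) (toℕ z)) (λ _ _ p → p))
      where yxz : ∀ x y z → y ℕ.+ x ℕ.+ z ≡ x ℕ.+ y ℕ.+ z
            yxz = solve-∀
    ...    | no _    = inj₂ (λ _ → refl)
    coord-index x y z | no _ | yes y<z | no _ with z <? x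
    ...    | yes z<x = inj₁ (index (triple y z x y<z z<x) (λ _ → refl) (yzx (toℕ x) (toℕ y) (toℕ z)) (λ p _ _ → p))
      where yzx : ∀ x y z → y ℕ.+ z ℕ.+ x ≡ x ℕ.+ y ℕ.+ z
            yzx = solve-∀
    ...    | no _    = inj₂ (λ _ → refl)
    coord-index x y z | no _ | no _ | _ with z <? y | y <? x
    ...    | yes z<y | yes y<x = inj₁ (index (triple z y x z<y y<x) (λ _ → refl) (zyx (toℕ x) (toℕ y) (toℕ z)) (λ p _ _ → p))
      where zyx : ∀ x y z → z ℕ.+ y ℕ.+ x ≡ x ℕ.+ y ℕ.+ z
            zyx = solve-∀
    ...    | yes _   | no _    = inj₂ (λ _ → refl)
    ...    | no _    | _       = inj₂ (λ _ → refl)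

    coord-sorted : ∀ (u : Point n) t → coord u (a t) (b t) (c t) ≡ u t
    coord-sorted u t with a t <? b t | b t <? c t | a t <? c t
    ... | yes _ | yes _ | _ = cong u (triple-≡ refl refl refl)
    ... | no ¬p | _     | _ = contradiction (a<b t) ¬p
    ... | yes _ | no ¬q | _ = contradiction (b<c t) ¬q

    coordF : Fin n → Fin n → Fin n → Functional (Triple n)
    coordF x y z .fun u = coord u x y z
    coordF x y z .ext {u} {v} u≗v with coord-index x y z
    ... | inj₁ I    = trans (Index.value≡ I u) (trans (u≗v _) (sym (Index.value≡ I v)))
    ... | inj₂ ≡0   = trans (≡0 u) (sym (≡0 v))
    coordF x y z .lin r u v with coord-index x y z
    ... | inj₁ I    = trans (Index.value≡ I _) (cong₂ (λ p q → r * p + q) (sym (Index.value≡ I u)) (sym (Index.value≡ I v)))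
    ... | inj₂ ≡0   = trans (≡0 _) (sym (trans (cong₂ (λ p q → r * p + q) (≡0 u) (≡0 v))
                                                (trans (+-identityʳ (r * 0ℚ)) (*-zeroʳ r))))

  -- Legs of a tropical line and convexity.

  Leg : ℚ → ℚ → ℚ → Set
  Leg x y z = x ≡ y × x ≤ z

  MinTwice-swap : ∀ {x y z} → MinTwice x y z → MinTwice x z y
  MinTwice-swap (inj₁ l)                       = inj₂ (inj₁ l)
  MinTwice-swap (inj₂ (inj₁ l))                = inj₁ l
  MinTwice-swap {x} (inj₂ (inj₂ (y≡z , y≤x)))  = inj₂ (inj₂ (sym y≡z , subst (_≤ x) y≡z y≤x))

  MinTwice-rotate : ∀ {x y z} → MinTwice x y z → MinTwice y z x
  MinTwice-rotate {z = z} (inj₁ (x≡y , x≤z))        = inj₂ (inj₁ (sym x≡y , subst (_≤ z) x≡y x≤z))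
  MinTwice-rotate {y = y} (inj₂ (inj₁ (x≡z , x≤y))) = inj₂ (inj₂ (sym x≡z , subst (_≤ y) x≡z x≤y))
  MinTwice-rotate (inj₂ (inj₂ l))                   = inj₁ l

  no-strict-min : ∀ {x y z} → z < x → z < y → ¬ MinTwice x y z
  no-strict-min z<x z<y (inj₁ (_ , x≤z))          = <-irrefl refl (<-≤-trans z<x x≤z)
  no-strict-min z<x z<y (inj₂ (inj₁ (x≡z , _)))   = <-irrefl (sym x≡z) z<x
  no-strict-min z<x z<y (inj₂ (inj₂ (y≡z , _)))   = <-irrefl (sym y≡z) z<y

  +-cancelˡ-≤ : ∀ p {q r} → p + q ≤ p + r → q ≤ r
  +-cancelˡ-≤ p {q} {r} le = subst₂ _≤_ (undo q) (undo r) (+-monoʳ-≤ (- p) le)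
    where
    open +-*-Solver
    undo : ∀ q → - p + (p + q) ≡ q
    undo = solve 2 (λ p q → :- p :+ (p :+ q) := q) refl p

  +-cancelˡ-≡ : ∀ p {q r} → p + q ≡ p + r → q ≡ r
  +-cancelˡ-≡ p eq = ≤-antisym (+-cancelˡ-≤ p (≤-reflexive eq)) (+-cancelˡ-≤ p (≤-reflexive (sym eq)))

  +-deficit : ∀ {p q r s} → p < q → p + r ≡ q + s → s < r
  +-deficit {p} {q} {r} {s} p<q eq = ≰⇒> λ r≤s → <-irrefl eq (+-mono-<-≤ p<q r≤s)

  -- Legs of the tropical line meet only in its apex: a segment that starts
  -- in the interior of one leg and stays on the line ends on the same leg.
  same-leg : ∀ {x y z x′ y′ z′} → x ≡ y → x < z → MinTwice x′ y′ z′ →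
    MinTwice (x + x′) (y + y′) (z + z′) → Leg x′ y′ z′
  same-leg {x} {z′ = z′} refl x<z m′ (inj₁ (eq , _)) = x′≡y′ , x′≤z′ m′
    where
    x′≡y′ = +-cancelˡ-≡ x eq
    x′≤z′ : MinTwice _ _ z′ → _ ≤ z′
    x′≤z′ (inj₁ (_ , le))          = le
    x′≤z′ (inj₂ (inj₁ (eq′ , _)))  = ≤-reflexive eq′
    x′≤z′ (inj₂ (inj₂ (eq′ , _)))  = ≤-reflexive (trans x′≡y′ eq′)
  same-leg {x} refl x<z m′ (inj₂ (inj₁ (eq , le))) =
    let z′<x′ = +-deficit x<z eq in
    contradiction m′ (no-strict-min z′<x′ (<-≤-trans z′<x′ (+-cancelˡ-≤ x le)))
  same-leg {x} refl x<z m′ (inj₂ (inj₂ (eq , le))) =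
    let z′<y′ = +-deficit x<z eq in
    contradiction m′ (no-strict-min (<-≤-trans z′<y′ (+-cancelˡ-≤ x le)) z′<y′)

  Apex : ℚ → ℚ → ℚ → Set
  Apex x y z = x ≡ y × x ≡ z

  Strict : ℚ → ℚ → ℚ → Set
  Strict x y z = x ≡ y × x < z

  strict? : ∀ {x y z} → Leg x y z → Strict x y z ⊎ Apex x y z
  strict? {x} {y} {z} (x≡y , x≤z) with x ≟ z
  ... | yes x≡z = inj₂ (x≡y , x≡z)
  ... | no  x≢z = inj₁ (x≡y , ≤∧≢⇒< x≤z x≢z)
    where
    ≤∧≢⇒< : ∀ {p q} → p ≤ q → p ≢ q → p < q
    ≤∧≢⇒< p≤q p≢q = ≰⇒> λ q≤p → p≢q (≤-antisym p≤q q≤p)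

  position : ∀ {x y z} → MinTwice x y z →
    (Strict x y z ⊎ Strict x z y ⊎ Strict y z x) ⊎ Apex x y z
  position (inj₁ l) = Sum.map₁ inj₁ (strict? l)
  position (inj₂ (inj₁ l)) =
    Sum.map (inj₂ ∘ inj₁) (λ { (x≡z , x≡y) → x≡y , x≡z }) (strict? l)
  position (inj₂ (inj₂ l)) =
    Sum.map (inj₂ ∘ inj₂) (λ { (y≡z , y≡x) → sym y≡x , trans (sym y≡x) y≡z }) (strict? l)

  search : ∀ {m} {A B : Fin m → Set} → (∀ i → A i ⊎ B i) → (∃ A) ⊎ (∀ i → B i)
  search {zero}  f = inj₂ λ ()
  search {suc m} f with f zero | search (f ∘ suc)
  ... | inj₁ a | _            = inj₁ (zero , a)
  ... | inj₂ _ | inj₁ (i , a) = inj₁ (suc i , a)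
  ... | inj₂ b | inj₂ bs      = inj₂ λ { zero → b ; (suc i) → bs i }

  -- A vertex strictly inside a leg draws every other vertex onto it by `same-leg`. If there is
  -- none, all vertices sit at the apex, which belongs to every leg. Convexity is used only through
  -- midpoints, here in doubled form.
  one-leg : ∀ {m} (x y z : Fin m → ℚ) →
    (∀ i → MinTwice (x i) (y i) (z i)) →
    (∀ i j → MinTwice (x i + x j) (y i + y j) (z i + z j)) →
    (∀ i → Leg (x i) (y i) (z i)) ⊎ (∀ i → Leg (x i) (z i) (y i)) ⊎ (∀ i → Leg (y i) (z i) (x i))
  one-leg x y z single mid with search (λ i → position (single i))
  ... | inj₂ apex = inj₁ λ i → proj₁ (apex i) , ≤-reflexive (proj₂ (apex i))
  ... | inj₁ (i , inj₁ (e , l)) = inj₁ λ j → same-leg e l (single j) (mid i j)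
  ... | inj₁ (i , inj₂ (inj₁ (e , l))) =
    inj₂ (inj₁ λ j → same-leg e l (MinTwice-swap (single j)) (MinTwice-swap (mid i j)))
  ... | inj₁ (i , inj₂ (inj₂ (e , l))) =
    inj₂ (inj₂ λ j → same-leg e l (MinTwice-rotate (single j)) (MinTwice-rotate (mid i j)))

  MinTwice-resp : ∀ {x y z x′ y′ z′} → x ≡ x′ → y ≡ y′ → z ≡ z′ → MinTwice x y z → MinTwice x′ y′ z′
  MinTwice-resp refl refl refl t = t

  ½-double : ∀ x → ½ * (x + x) ≡ x
  ½-double = solve 1 (λ x → con ½ :* (x :+ x) := x) refl
    where open +-*-Solver

  MinTwice-½ : ∀ {x y z} → MinTwice (½ * x) (½ * y) (½ * z) → MinTwice x y z
  MinTwice-½ = Sum.map leg (Sum.map leg leg)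
    where
    leg : ∀ {x y z} → Leg (½ * x) (½ * y) (½ * z) → Leg x y z
    leg (eq , le) = ≤-antisym (*-cancelˡ-≤-pos ½ (≤-reflexive eq)) (*-cancelˡ-≤-pos ½ (≤-reflexive (sym eq))) ,
                    *-cancelˡ-≤-pos ½ le

  module Midpoint {m : ℕ} where
    open Unit (Fin._≟_ {m})

    midpoint : Fin m → Fin m → Fin m → ℚ
    midpoint i j k = ½ * unit i k + ½ * unit j k

    unit-nonNeg : ∀ i k → 0ℚ ≤ unit i k
    unit-nonNeg i k with i Fin.≟ k
    ... | yes _ = <⇒≤ (positive⁻¹ 1ℚ)
    ... | no  _ = ≤-refl

    midpoint-nonNeg : ∀ i j k → 0ℚ ≤ midpoint i j k
    midpoint-nonNeg i j k = +-nonNeg (*-nonNeg 0≤½ (unit-nonNeg i k)) (*-nonNeg 0≤½ (unit-nonNeg j k))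
      where 0≤½ = <⇒≤ (positive⁻¹ ½)

    sum-unit : ∀ i (g : Fin m → ℚ) → sumFin m (λ k → unit i k * g k) ≡ g i
    sum-unit i g = trans
      (sum-single m i (λ k k≢i → trans (cong (_* g k) (unit-≢ (k≢i ∘ sym))) (*-zeroˡ (g k))))
      (trans (cong (_* g i) (unit-refl i)) (*-identityˡ (g i)))

    sum-midpoint : ∀ i j (g : Fin m → ℚ) → sumFin m (λ k → midpoint i j k * g k) ≡ ½ * (g i + g j)
    sum-midpoint i j g = begin
      sumFin m (λ k → (½ * unit i k + ½ * unit j k) * g k)
        ≡⟨ sum-cong m (λ k → solve 4 (λ h a b g → (h :* a :+ h :* b) :* g := h :* (a :* g) :+ h :* (b :* g))
             refl ½ (unit i k) (unit j k) (g k)) ⟩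
      sumFin m (λ k → ½ * (unit i k * g k) + ½ * (unit j k * g k))
        ≡⟨ sum-lin m ½ _ _ ⟩
      ½ * sumFin m (λ k → unit i k * g k) + sumFin m (λ k → ½ * (unit j k * g k))
        ≡⟨ cong₂ _+_ (cong (½ *_) (sum-unit i g)) (trans (sum-* m ½ _) (cong (½ *_) (sum-unit j g))) ⟩
      ½ * g i + ½ * g j
        ≡⟨ *-distribˡ-+ ½ (g i) (g j) ⟨
      ½ * (g i + g j) ∎
      where open ≡-Reasoning
            open +-*-Solver

    sum-midpoint-1 : ∀ i j → sumFin m (midpoint i j) ≡ 1ℚ
    sum-midpoint-1 i j = trans (sum-cong m (λ k → sym (*-identityʳ (midpoint i j k)))) (sum-midpoint i j (λ _ → 1ℚ))

  -- The equation is entered as two opposite inequalities, so that every leg is cut out by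
  -- half-spaces alone, the only cuts that the double description handles.
  leg : ∀ {X} → Functional X → Functional X → Functional X → List (Functional X)
  leg f g h = (f ⊖ g) ∷ (g ⊖ f) ∷ (h ⊖ f) ∷ []

  sat-leg⁺ : ∀ {X} (f g h : Functional X) {u} → Leg (fun f u) (fun g u) (fun h u) → Sat (leg f g h) u
  sat-leg⁺ f g h (eq , le) =
    p≤q⇒0≤q-p (≤-reflexive (sym eq)) ∷ p≤q⇒0≤q-p (≤-reflexive eq) ∷ p≤q⇒0≤q-p le ∷ []

  sat-leg⁻ : ∀ {X} (f g h : Functional X) {u} → Sat (leg f g h) u → Leg (fun f u) (fun g u) (fun h u)
  sat-leg⁻ f g h (p ∷ q ∷ r ∷ []) = ≤-antisym (0≤q-p⇒p≤q q) (0≤q-p⇒p≤q p) , 0≤q-p⇒p≤q r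

  -- The Dressian as a finite union of cones, and its dimension.

  Quintuple : ℕ → Set
  Quintuple n = Fin n × Fin n × Fin n × Fin n × Fin n

  Distinct : ∀ {n} → Quintuple n → Set
  Distinct (h , i , j , k , l) = Distinct5 h i j k l

  distinct? : ∀ {n} (q : Quintuple n) → Dec (Distinct q)
  distinct? (h , i , j , k , l) =
    h ≢? i ×-dec h ≢? j ×-dec h ≢? k ×-dec h ≢? l ×-dec i ≢? j ×-dec
    i ≢? k ×-dec i ≢? l ×-dec j ≢? k ×-dec j ≢? l ×-dec k ≢? l
    where
    infix 4 _≢?_
    _≢?_ : ∀ {n} (x y : Fin n) → Dec (x ≢ y)
    x ≢? y = ¬? (x Fin.≟ y)

  quintuples : ∀ n → List (Quintuple n)
  quintuples n = cartesianProduct F (cartesianProduct F (cartesianProduct F (cartesianProduct F F)))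
    where F = allFin n

  ∈-quintuples : ∀ {n} (q : Quintuple n) → q ∈ quintuples n
  ∈-quintuples (h , i , j , k , l) =
    ∈-cartesianProduct⁺ (∈-allFin h) (∈-cartesianProduct⁺ (∈-allFin i) (∈-cartesianProduct⁺ (∈-allFin j)
      (∈-cartesianProduct⁺ (∈-allFin k) (∈-allFin l))))

  module _ {n : ℕ} where

    pairing₁ pairing₂ pairing₃ : Quintuple n → Functional (Triple n)
    pairing₁ (h , i , j , k , l) = coordF h i j ⊕ coordF h k l
    pairing₂ (h , i , j , k , l) = coordF h i k ⊕ coordF h j l
    pairing₃ (h , i , j , k , l) = coordF h i l ⊕ coordF h j k

    MinTwiceAt : Quintuple n → Point n → Set
    MinTwiceAt q u = MinTwice (fun (pairing₁ q) u) (fun (pairing₂ q) u) (fun (pairing₃ q) u)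

    leg₁ leg₂ leg₃ : Quintuple n → List (Functional (Triple n))
    leg₁ q = leg (pairing₁ q) (pairing₂ q) (pairing₃ q)
    leg₂ q = leg (pairing₁ q) (pairing₃ q) (pairing₂ q)
    leg₃ q = leg (pairing₂ q) (pairing₃ q) (pairing₁ q)

    legs-if : ∀ q → Dec (Distinct q) → List (List (Functional (Triple n)))
    -- One empty system rather than no system: the product in `cones` must survive a quintuple that
    -- imposes no condition.
    legs-if q (no  _) = [] ∷ []
    legs-if q (yes _) = leg₁ q ∷ leg₂ q ∷ leg₃ q ∷ []

    legs : Quintuple n → List (List (Functional (Triple n)))
    legs q = legs-if q (distinct? q)

    legs-sound : ∀ q {fs u} → fs ∈ legs q → Sat fs u → Distinct q → MinTwiceAt q u
    legs-sound q {u = u} = sound (distinct? q)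
      where
      sound : ∀ d? {fs} → fs ∈ legs-if q d? → Sat fs u → Distinct q → MinTwiceAt q u
      sound (no ¬d) _ _ d                              = contradiction d ¬d
      sound (yes _) (here refl) sat _                  = inj₁ (sat-leg⁻ (pairing₁ q) (pairing₂ q) (pairing₃ q) sat)
      sound (yes _) (there (here refl)) sat _          = inj₂ (inj₁ (sat-leg⁻ (pairing₁ q) (pairing₃ q) (pairing₂ q) sat))
      sound (yes _) (there (there (here refl))) sat _  = inj₂ (inj₂ (sat-leg⁻ (pairing₂ q) (pairing₃ q) (pairing₁ q) sat))

    module _ {m : ℕ} {p : Fin (suc m) → Point n} (hull : HullInDressian n m p) where
      open Midpoint {suc m}

      hull-mid : ∀ q → Distinct q → ∀ i j → MinTwice
        (½ * (fun (pairing₁ q) (p i) + fun (pairing₁ q) (p j)))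
        (½ * (fun (pairing₂ q) (p i) + fun (pairing₂ q) (p j)))
        (½ * (fun (pairing₃ q) (p i) + fun (pairing₃ q) (p j)))
      hull-mid q@(h , i′ , j′ , k , l) d i j =
        MinTwice-resp (value (pairing₁ q)) (value (pairing₂ q)) (value (pairing₃ q))
          (hull (midpoint i j) (midpoint-nonNeg i j) (sum-midpoint-1 i j) h i′ j′ k l d)
        where
        value : ∀ f → fun f (comb (suc m) (midpoint i j) p) ≡ ½ * (fun f (p i) + fun f (p j))
        value f = trans (fun-comb f (suc m) (midpoint i j) p) (sum-midpoint i j (λ k → fun f (p k)))

      hull-leg : ∀ q → Distinct q → let f = pairing₁ q ; g = pairing₂ q ; h = pairing₃ q in
        (∀ i → Leg (fun f (p i)) (fun g (p i)) (fun h (p i))) ⊎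
        (∀ i → Leg (fun f (p i)) (fun h (p i)) (fun g (p i))) ⊎
        (∀ i → Leg (fun g (p i)) (fun h (p i)) (fun f (p i)))
      hull-leg q d = one-leg (λ i → fun (pairing₁ q) (p i)) (λ i → fun (pairing₂ q) (p i)) (λ i → fun (pairing₃ q) (p i))
        -- The midpoint of a vertex with itself is the vertex.
        (λ i → MinTwice-resp (½-double (fun (pairing₁ q) (p i))) (½-double (fun (pairing₂ q) (p i))) (½-double (fun (pairing₃ q) (p i))) (hull-mid q d i i))
        (λ i j → MinTwice-½ (hull-mid q d i j))

      legs-complete : ∀ q → ∃[ fs ] fs ∈ legs q × (∀ i → Sat fs (p i))
      legs-complete q = complete (distinct? q)
        where
        complete : ∀ d? → ∃[ fs ] fs ∈ legs-if q d? × (∀ i → Sat fs (p i))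
        complete (no _)  = [] , here refl , λ _ → []
        complete (yes d) =
          [ (λ l → leg₁ q , here refl , λ i → sat-leg⁺ (pairing₁ q) (pairing₂ q) (pairing₃ q) {p i} (l i))
          , [ (λ l → leg₂ q , there (here refl) , λ i → sat-leg⁺ (pairing₁ q) (pairing₃ q) (pairing₂ q) {p i} (l i))
            , (λ l → leg₃ q , there (there (here refl)) , λ i → sat-leg⁺ (pairing₂ q) (pairing₃ q) (pairing₁ q) {p i} (l i))
            ]′ ]′ (hull-leg q d)

    cones : List (Quintuple n) → List (List (Functional (Triple n)))
    cones []       = [] ∷ []
    cones (q ∷ qs) = cartesianProductWith _++_ (legs q) (cones qs)

    cones-sound : ∀ qs {fs u} → fs ∈ cones qs → Sat fs u → ∀ {q} → q ∈ qs → Distinct q → MinTwiceAt q u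
    cones-sound (q ∷ qs) fs∈ sat q∈ d with ∈-cartesianProductWith⁻ _++_ (legs q) (cones qs) fs∈
    ... | gs , hs , gs∈ , hs∈ , refl with ++⁻ gs sat | q∈
    ...   | sat-gs , _      | here refl = legs-sound q gs∈ sat-gs d
    ...   | _      , sat-hs | there q∈′ = cones-sound qs hs∈ sat-hs q∈′ d

    cones-complete : ∀ {m p} → HullInDressian n m p → ∀ qs → ∃[ fs ] fs ∈ cones qs × (∀ i → Sat fs (p i))
    cones-complete hull []       = [] , here refl , λ _ → []
    cones-complete hull (q ∷ qs) with legs-complete hull q | cones-complete hull qs
    ... | gs , gs∈ , sat-gs | hs , hs∈ , sat-hs =
      gs ++ hs , ∈-cartesianProductWith⁺ _++_ gs∈ hs∈ , λ i → ++⁺ (sat-gs i) (sat-hs i)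

    cone⊆Dressian : ∀ {fs u} → fs ∈ cones (quintuples n) → Sat fs u → InDressian n u
    cone⊆Dressian fs∈ sat h i j k l d =
      cones-sound (quintuples n) fs∈ sat (∈-quintuples (h , i , j , k , l)) d

    SimplexIn : List (Functional (Triple n)) → ℕ → Set
    SimplexIn fs m = ∃[ p ] AffinelyIndependent {n} m p × (∀ i → Sat fs (p i))

    -- A basis picked among the generators spans a simplex inside the cone. Conversely all points of
    -- the cone, hence all edges of a simplex in it, lie in the span of that basis, and `steinitz`
    -- applies.
    cone-dimension : ∀ {fs} → fs ∈ cones (quintuples n) →
      ∃[ r ] ContainsSimplex n r × (∀ {m} → SimplexIn fs m → m ℕ.≤ r)
    cone-dimension {fs} fs∈ = rank , (p , affine , hull) , bound
      where
      open +-*-Solver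
      open Generators _≟ₜ_ triples ∈-triples using (generators)
      G    = proj₁ (generators fs)
      satG = proj₁ (proj₂ (generators fs))
      cone = proj₂ (proj₂ (generators fs))
      open Basis (basis triples ∈-triples G)
      p : Fin (suc rank) → Point n
      -- With the origin as first vertex, which satisfies every homogeneous inequality, the edges
      -- are the basis vectors themselves.
      p = cons (λ _ → 0ℚ) vec
      affine : AffinelyIndependent rank p
      affine c rel = independent c (λ t → trans
        (sum-cong rank (λ i → cong (c i *_) (sym (+-identityʳ (vec i t))))) (rel t))
      sat-p : ∀ i → Sat fs (p i)
      sat-p zero    = All.tabulate (λ {f} _ → ≤-reflexive (sym (fun-0 f (λ _ → refl))))
      sat-p (suc i) = satG (vec∈ i)
      hull : HullInDressian n rank p
      hull w 0≤w _ = cone⊆Dressian fs∈ (sat-comb {v = p} 0≤w sat-p)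
      bound : ∀ {m} → SimplexIn fs m → m ℕ.≤ rank
      bound {m} (s , indep , sat) = steinitz {u = λ i t → s (suc i) t - s zero t}
        (λ i → span-lin (- 1ℚ) (spans zero) (spans (suc i))
          (λ t → solve 2 (λ x y → y :- x := (:- con 1ℚ) :* x :+ y) refl (s zero t) (s (suc i) t)))
        indep
        where
        spans : ∀ i → Span rank vec (s i)
        spans i = cone-span spanning (cone (sat i))

  -- The starting value `m₀` answers for the empty list and remains a lower bound, so the packing
  -- simplex supplies both the start and the estimate of `D` from below.
  maximum : ∀ {A : Set} {P : ℕ → Set} {R : A → ℕ → Set} (xs : List A) {m₀} → P m₀ →
    (∀ {x} → x ∈ xs → ∃[ r ] P r × (∀ {m} → R x m → m ℕ.≤ r)) →
    ∃[ D ] m₀ ℕ.≤ D × P D × (∀ {x m} → x ∈ xs → R x m → m ℕ.≤ D)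
  maximum []       {m₀} pm₀ f = m₀ , ℕ.≤-refl , pm₀ , λ ()
  maximum (x ∷ xs) pm₀ f with maximum xs pm₀ (f ∘ there) | f (here refl)
  ... | D , m₀≤D , pD , D-max | r , pr , r-max with ℕ.≤-total r D
  ...   | inj₁ r≤D = D , m₀≤D , pD , λ { (here refl) Rm → ℕ.≤-trans (r-max Rm) r≤D ; (there x∈) Rm → D-max x∈ Rm }
  ...   | inj₂ D≤r = r , ℕ.≤-trans m₀≤D D≤r , pr , λ { (here refl) Rm → r-max Rm ; (there x∈) Rm → ℕ.≤-trans (D-max x∈ Rm) D≤r }

  dimension : ∀ {n m₀} → ContainsSimplex n m₀ → ∃[ D ] m₀ ℕ.≤ D × FanDimension n D
  dimension {n} simplex =
    let D , m₀≤D , contains , max = maximum {R = SimplexIn} (cones (quintuples n)) simplex cone-dimension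
    in D , m₀≤D , contains , λ { (p , indep , hull) →
         let fs , fs∈ , sat = cones-complete hull (quintuples n) in
         ℕ.1+n≰n (max fs∈ (p , indep , sat)) }

-- The quadratic upper bound.

module UpperBound where

  open LinearAlgebra
  open Cones
  open FanDimensions
  open import Data.Rational using (ℚ; 0ℚ; 1ℚ; _+_; _-_; _*_; -_)
  open import Data.Rational.Properties
  open import Data.Rational.Solver using (module +-*-Solver)

  search-∈ : ∀ {A : Set} {P Q : A → Set} (xs : List A) → (∀ {x} → x ∈ xs → P x ⊎ Q x) →
    (∃[ x ] x ∈ xs × P x) ⊎ (∀ {x} → x ∈ xs → Q x)
  search-∈ []       f = inj₂ λ ()
  search-∈ (x ∷ xs) f with f (here refl) | search-∈ xs (f ∘ there)
  ... | inj₁ p | _                = inj₁ (x , here refl , p)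
  ... | inj₂ _ | inj₁ (y , y∈ , p) = inj₁ (y , there y∈ , p)
  ... | inj₂ q | inj₂ qs           = inj₂ λ { (here refl) → q ; (there x∈) → qs x∈ }

  -- Fix the first element `x`. For each `y`, the alternatives for `x`, `y`, `z` either show that
  -- `x` and `y` together cover everything or yield `E x y`. If no `y` gives the former, `x` alone
  -- covers. This avoids deciding `E`.
  two-cover : ∀ {A : Set} (E : A → A → Set) (xs : List A) →
    (∀ {x y z} → x ∈ xs → y ∈ xs → z ∈ xs → E x y ⊎ E x z ⊎ E y z) →
    ∃[ ys ] length ys ℕ.≤ 2 × (∀ {z} → z ∈ xs → ∃[ y ] y ∈ ys × E y z)
  two-cover E []          F = [] , z≤n , λ ()
  two-cover E xs@(x ∷ _) F with search-∈ xs covers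
    where
    covers : ∀ {y} → y ∈ xs → (∀ {z} → z ∈ xs → E x z ⊎ E y z) ⊎ E x y
    covers {y} y∈ = [ (λ { (_ , _ , e) → inj₂ e }) , inj₁ ]′ (search-∈ xs (F (here refl) y∈))
  ... | inj₁ (y , _ , cov) = x ∷ y ∷ [] , s≤s (s≤s z≤n) ,
    λ z∈ → [ (λ e → x , here refl , e) , (λ e → y , there (here refl) , e) ]′ (cov z∈)
  ... | inj₂ cov = x ∷ [] , s≤s z≤n , λ z∈ → x , here refl , cov z∈

  length-concatMap-≤ : ∀ {A B : Set} (f : A → List B) {k} → (∀ x → length (f x) ℕ.≤ k) →
    ∀ xs → length (concatMap f xs) ℕ.≤ length xs ℕ.* k
  length-concatMap-≤ f le []       = z≤n
  length-concatMap-≤ f le (x ∷ xs) =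
    subst (ℕ._≤ _) (sym (length-++ (f x))) (ℕ.+-mono-≤ (le x) (length-concatMap-≤ f le xs))

  length-allFin : ∀ n → length (allFin n) ≡ n
  length-allFin n = length-tabulate {n = n} id

  module _ {n m : ℕ} (p : Fin (suc m) → Point n) (hull : HullInDressian n m p) where

    open Triple

    edge : Fin m → Point n
    edge i t = p (suc i) t - p zero t

    fun-edge : ∀ f i → fun f (edge i) ≡ fun f (p (suc i)) - fun f (p zero)
    fun-edge f i = begin
      fun f (edge i)                                    ≡⟨ ext f (λ t → flip (p zero t) (p (suc i) t)) ⟩
      fun f (λ t → - 1ℚ * p zero t + p (suc i) t)       ≡⟨ lin f (- 1ℚ) (p zero) (p (suc i)) ⟩
      - 1ℚ * fun f (p zero) + fun f (p (suc i))         ≡⟨ flip (fun f (p zero)) (fun f (p (suc i))) ⟨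
      fun f (p (suc i)) - fun f (p zero)                ∎
      where
      open ≡-Reasoning
      open +-*-Solver
      flip : ∀ x y → y - x ≡ - 1ℚ * x + y
      flip = solve 2 (λ x y → y :- x := (:- con 1ℚ) :* x :+ y) refl

    -- Only the equation of a leg passes to combinations of edges with arbitrary signs; its
    -- inequality would not.
    agree : ∀ f g → (∀ i → fun f (p i) ≡ fun g (p i)) → ∀ d → fun f (comb m d edge) ≡ fun g (comb m d edge)
    agree f g eq d = begin
      fun f (comb m d edge)                 ≡⟨ fun-comb f m d edge ⟩
      sumFin m (λ i → d i * fun f (edge i)) ≡⟨ sum-cong m (λ i → cong (d i *_) (begin
        fun f (edge i)                        ≡⟨ fun-edge f i ⟩
        fun f (p (suc i)) - fun f (p zero)    ≡⟨ cong₂ _-_ (eq (suc i)) (eq zero) ⟩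
        fun g (p (suc i)) - fun g (p zero)    ≡⟨ fun-edge g i ⟨
        fun g (edge i)                        ∎)) ⟩
      sumFin m (λ i → d i * fun g (edge i)) ≡⟨ fun-comb g m d edge ⟨
      fun g (comb m d edge)                 ∎
      where open ≡-Reasoning

    VanishBelow : ℕ → Point n → Set
    VanishBelow k u = ∀ t → toℕ (c t) ℕ.< k → u t ≡ 0ℚ

    vanish-coord : ∀ {k u x y z} → VanishBelow k u → toℕ x ℕ.< k → toℕ y ℕ.< k → toℕ z ℕ.< k →
      coord u x y z ≡ 0ℚ
    vanish-coord {u = u} {x} {y} {z} low x<k y<k z<k =
      [ (λ I → trans (Index.value≡ I u) (low (Index.t I) (Index.c< I x<k y<k z<k))) , (λ ≡0 → ≡0 u) ]′
        (coord-index x y z)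

    -- The quantifier over `d` is inside, because the probes must be chosen once for all
    -- combinations. The threshold is read off `s`; in the links built below, `t` has the same
    -- largest element.
    Linked : Triple n → Triple n → Set
    Linked s t = ∀ d → VanishBelow (toℕ (c s)) (comb m d edge) → comb m d edge s ≡ comb m d edge t

    -- Modulo the coordinates below k, the three pairings of h | x y z k are
    -- the coordinates hzk, hyk and hxk, and two pairings agree on the simplex.
    linked-distinct : ∀ {h x y z k} (hx : h Fin.< x) (xk : x Fin.< k) (hy : h Fin.< y) (yk : y Fin.< k)
      (hz : h Fin.< z) (zk : z Fin.< k) → x ≢ y → x ≢ z → y ≢ z →
      Linked (triple h x k hx xk) (triple h y k hy yk) ⊎
      Linked (triple h x k hx xk) (triple h z k hz zk) ⊎
      Linked (triple h y k hy yk) (triple h z k hz zk)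
    linked-distinct {h} {x} {y} {z} {k} hx xk hy yk hz zk x≢y x≢z y≢z =
      [ (λ l → inj₂ (inj₂ λ d low → sym (link (at₁ low) (at₂ low) (agree (pairing₁ q) (pairing₂ q) (proj₁ ∘ l) d))))
      , [ (λ l → inj₂ (inj₁ λ d low → sym (link (at₁ low) (at₃ low) (agree (pairing₁ q) (pairing₃ q) (proj₁ ∘ l) d))))
        , (λ l → inj₁ λ d low → sym (link (at₂ low) (at₃ low) (agree (pairing₂ q) (pairing₃ q) (proj₁ ∘ l) d)))
        ]′ ]′ (hull-leg hull q distinct)
      where
      q : Quintuple n
      q = h , x , y , z , k
      hk : h Fin.< k
      hk = ℕ.<-trans hx xk
      distinct : Distinct q
      distinct = Fin.<⇒≢ hx , Fin.<⇒≢ hy , Fin.<⇒≢ hz , Fin.<⇒≢ hk , x≢y , x≢z , Fin.<⇒≢ xk ,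
                 y≢z , Fin.<⇒≢ yk , Fin.<⇒≢ zk
      at₁ : ∀ {u} → VanishBelow (toℕ k) u → fun (pairing₁ q) u ≡ u (triple h z k hz zk)
      at₁ {u} low = trans (cong₂ _+_ (vanish-coord low hk xk yk) (coord-sorted u (triple h z k hz zk)))
                          (+-identityˡ _)
      at₂ : ∀ {u} → VanishBelow (toℕ k) u → fun (pairing₂ q) u ≡ u (triple h y k hy yk)
      at₂ {u} low = trans (cong₂ _+_ (vanish-coord low hk xk zk) (coord-sorted u (triple h y k hy yk)))
                          (+-identityˡ _)
      at₃ : ∀ {u} → VanishBelow (toℕ k) u → fun (pairing₃ q) u ≡ u (triple h x k hx xk)
      at₃ {u} low = trans (cong₂ _+_ (coord-sorted u (triple h x k hx xk)) (vanish-coord low hk yk zk))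
                          (+-identityʳ _)
      link : ∀ {v w v′ w′ : ℚ} → v ≡ v′ → w ≡ w′ → v ≡ w → v′ ≡ w′
      link refl refl e = e

    linked : ∀ {h k s t r} → a s ≡ h × c s ≡ k → a t ≡ h × c t ≡ k → a r ≡ h × c r ≡ k →
      Linked s t ⊎ Linked s r ⊎ Linked t r
    linked {s = s@(triple h x k hx xk)} {t@(triple _ y _ hy yk)} {r@(triple _ z _ hz zk)}
           (refl , refl) (refl , refl) (refl , refl) =
      cases (x Fin.≟ y) (x Fin.≟ z) (y Fin.≟ z)
      where
      same : ∀ {s t} → s ≡ t → Linked s t
      same refl _ _ = refl
      cases : Dec (x ≡ y) → Dec (x ≡ z) → Dec (y ≡ z) → Linked s t ⊎ Linked s r ⊎ Linked t r
      cases (yes e) _       _       = inj₁ (same (triple-≡ refl e refl))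
      cases (no _)  (yes e) _       = inj₂ (inj₁ (same (triple-≡ refl e refl)))
      cases (no _)  (no _)  (yes e) = inj₂ (inj₂ (same (triple-≡ refl e refl)))
      cases (no x≢y) (no x≢z) (no y≢z) = linked-distinct hx xk hy yk hz zk x≢y x≢z y≢z

    ends? : ∀ h k (t : Triple n) → Dec (a t ≡ h × c t ≡ k)
    ends? h k t = a t Fin.≟ h ×-dec c t Fin.≟ k

    pencil : Fin n → Fin n → List (Triple n)
    pencil h k = filter (ends? h k) triples

    pencil-cover : ∀ h k → ∃[ ys ] length ys ℕ.≤ 2 × (∀ {z} → z ∈ pencil h k → ∃[ y ] y ∈ ys × Linked z y)
    -- The relation is reversed so that a link leads from a covered triple to its probe; accordingly
    -- `linked` receives the three triples in reverse order.
    pencil-cover h k = two-cover (λ y z → Linked z y) (pencil h k) λ x∈ y∈ z∈ →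
      [ inj₂ ∘ inj₂ , [ inj₂ ∘ inj₁ , inj₁ ]′ ]′ (linked (ends z∈) (ends y∈) (ends x∈))
      where
      ends : ∀ {t} → t ∈ pencil h k → a t ≡ h × c t ≡ k
      ends = proj₂ ∘ ∈-filter⁻ (ends? h k) {xs = triples}

    row : Fin n → List (Triple n)
    row h = concatMap (λ k → proj₁ (pencil-cover h k)) (allFin n)

    probes : List (Triple n)
    probes = concatMap row (allFin n)

    length-row : ∀ h → length (row h) ℕ.≤ n ℕ.* 2
    length-row h = subst (λ l → length (row h) ℕ.≤ l ℕ.* 2) (length-allFin n)
      (length-concatMap-≤ (λ k → proj₁ (pencil-cover h k)) (λ k → proj₁ (proj₂ (pencil-cover h k))) (allFin n))

    length-probes : length probes ℕ.≤ n ℕ.* (n ℕ.* 2)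
    length-probes = subst (λ l → length probes ℕ.≤ l ℕ.* (n ℕ.* 2)) (length-allFin n)
      (length-concatMap-≤ row length-row (allFin n))

    ∈-probes : ∀ {h k t} → t ∈ proj₁ (pencil-cover h k) → t ∈ probes
    ∈-probes {h} {k} t∈ = ∈-concatMap⁺ row (lose (∈-allFin h)
      (∈-concatMap⁺ (λ k → proj₁ (pencil-cover h k)) (lose (∈-allFin k) t∈)))

    -- Induction on the largest element: once all coordinates with a smaller one vanish, a link
    -- identifies the coordinate at `t` with that at a probe.
    probes-determine : ∀ d → All (λ t → comb m d edge t ≡ 0ℚ) probes → ∀ t → comb m d edge t ≡ 0ℚ
    probes-determine d zeros t = below (suc (toℕ (c t))) t ℕ.≤-refl
      where
      below : ∀ k → VanishBelow k (comb m d edge)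
      below (suc k) t (s≤s ct≤k) =
        let y , y∈ , link = proj₂ (proj₂ (pencil-cover (a t) (c t)))
                              (∈-filter⁺ (ends? (a t) (c t)) (∈-triples t) (refl , refl))
        in trans (link d (λ s cs<ct → below k s (ℕ.<-≤-trans cs<ct ct≤k)))
                 (All.lookup zeros (∈-probes y∈))

  -- A relation among the edges that holds at the probes holds everywhere, contradicting affine
  -- independence; so elimination at the probes ends with the bound by their number.
  simplex-bound : ∀ {n m} → ContainsSimplex n m → m ℕ.≤ n ℕ.* (n ℕ.* 2)
  simplex-bound {n} {m} (p , indep , hull) =
    [ (λ { (d , (i , di≢0) , rel) → contradiction (indep d (probes-determine p hull d rel) i) di≢0 })
    , (λ { (_ , m≤) → ℕ.≤-trans m≤ (length-probes p hull) })
    ]′ (gauss m (edge p hull) (probes p hull))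

-- The quadratic lower bound.

module LowerBound where

  open LinearAlgebra
  open Cones
  open FanDimensions
  open import Data.Rational using (ℚ; 0ℚ; 1ℚ; _+_; _-_; _*_; _≤_)
  open import Data.Rational.Properties

  module _ {n : ℕ} where

    -- A sufficient condition for lying in the Dressian that, unlike `InDressian`, is closed under
    -- nonnegative combinations; it therefore passes from vertices to the hull.
    record Packed (u : Point n) : Set where
      field
        nonNeg  : ∀ t → 0ℚ ≤ u t
        support : ∀ t → u t ≡ 0ℚ ⊎ weight t ≡ n

    -- A triple of weight n is determined by any two of its elements, so at
    -- most one of the three pairings is nonzero.
    packed⇒Dressian : ∀ {u} → Packed u → InDressian n u
    packed⇒Dressian {u} P h i j k l (_ , _ , _ , _ , i≢j , i≢k , i≢l , j≢k , j≢l , k≢l) =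
      pairing (supp i j) (supp k l) (supp i k) (supp j l)
      where
      open Packed P
      -- A datatype rather than the bare equation, so that `x` and `y` can be inferred from a proof.
      data Block (x y : Fin n) : Set where
        block : toℕ h ℕ.+ toℕ x ℕ.+ toℕ y ≡ n → Block x y
      supp : ∀ x y → coord u h x y ≡ 0ℚ ⊎ Block x y
      supp x y = [ (λ I → Sum.map (trans (Index.value≡ I u)) (λ w → block (trans (sym (Index.weight≡ I)) w))
                                  (support (Index.t I)))
                 , (λ ≡0 → inj₁ (≡0 u)) ]′ (coord-index h x y)
      off : ∀ x y → ¬ Block x y → coord u h x y ≡ 0ℚ
      off x y ¬b = [ id , (λ b → contradiction b ¬b) ]′ (supp x y)
      pos : ∀ x y → 0ℚ ≤ coord u h x y
      pos x y = [ (λ I → subst (0ℚ ≤_) (sym (Index.value≡ I u)) (nonNeg (Index.t I)))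
                , (λ ≡0 → ≤-reflexive (sym (≡0 u))) ]′ (coord-index h x y)
      swap : ∀ {x y} → Block x y → Block y x
      swap {x} {y} (block w) = block (trans (eq (toℕ h) (toℕ x) (toℕ y)) w)
        where eq : ∀ h x y → h ℕ.+ y ℕ.+ x ≡ h ℕ.+ x ℕ.+ y
              eq = solve-∀
      -- The indices tell the position of the shared element in each pair.
      share₁₁ : ∀ {x y z} → Block x y → y ≢ z → ¬ Block x z
      share₁₁ {x} {y} {z} (block w) y≢z (block w′) =
        y≢z (Fin.toℕ-injective (ℕ.+-cancelˡ-≡ (toℕ h ℕ.+ toℕ x) (toℕ y) (toℕ z) (trans w (sym w′))))
      share₁₂ : ∀ {x y z} → Block x y → y ≢ z → ¬ Block z x
      share₁₂ w y≢z w′ = share₁₁ w y≢z (swap w′)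
      share₂₁ : ∀ {x y z} → Block x y → x ≢ z → ¬ Block y z
      share₂₁ w = share₁₁ (swap w)
      share₂₂ : ∀ {x y z} → Block x y → x ≢ z → ¬ Block z y
      share₂₂ w = share₁₂ (swap w)
      0+0 : ∀ x y x′ y′ → ¬ Block x y → ¬ Block x′ y′ → coord u h x y + coord u h x′ y′ ≡ 0ℚ
      0+0 x y x′ y′ ¬b ¬b′ = cong₂ _+_ (off x y ¬b) (off x′ y′ ¬b′)
      0≤+ : ∀ {s} x y x′ y′ → s ≡ 0ℚ → s ≤ coord u h x y + coord u h x′ y′
      0≤+ x y x′ y′ refl = +-nonNeg (pos x y) (pos x′ y′)
      Goal : Set
      Goal = MinTwice (coord u h i j + coord u h k l) (coord u h i k + coord u h j l) (coord u h i l + coord u h j k)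
      -- The subscript names the pairing that may be positive; the other two are 0 and attain the
      -- minimum.
      outside₁ : ¬ Block i k → ¬ Block j l → ¬ Block i l → ¬ Block j k → Goal
      outside₁ ik jl il jk = let e = 0+0 i k j l ik jl in
        inj₂ (inj₂ (trans e (sym (0+0 i l j k il jk)) , 0≤+ i j k l e))
      outside₂ : ¬ Block i j → ¬ Block k l → ¬ Block i l → ¬ Block j k → Goal
      outside₂ ij kl il jk = let e = 0+0 i j k l ij kl in
        inj₂ (inj₁ (trans e (sym (0+0 i l j k il jk)) , 0≤+ i k j l e))
      outside₃ : coord u h i j ≡ 0ℚ → coord u h k l ≡ 0ℚ → coord u h i k ≡ 0ℚ → coord u h j l ≡ 0ℚ → Goal
      outside₃ ij kl ik jl = let e = cong₂ _+_ ij kl in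
        inj₁ (trans e (sym (cong₂ _+_ ik jl)) , 0≤+ i l j k e)
      -- Four of the six coordinates decide: if none of them is a block, the first two pairings are
      -- already 0.
      pairing : coord u h i j ≡ 0ℚ ⊎ Block i j → coord u h k l ≡ 0ℚ ⊎ Block k l →
                coord u h i k ≡ 0ℚ ⊎ Block i k → coord u h j l ≡ 0ℚ ⊎ Block j l → Goal
      pairing (inj₂ ij) _ _ _ =
        outside₁ (share₁₁ ij j≢k) (share₂₁ ij i≢l) (share₁₁ ij j≢l) (share₂₁ ij i≢k)
      pairing _ (inj₂ kl) _ _ =
        outside₁ (share₁₂ kl (i≢l ∘ sym)) (share₂₂ kl (j≢k ∘ sym)) (share₂₂ kl (i≢k ∘ sym)) (share₁₂ kl (j≢l ∘ sym))
      pairing _ _ (inj₂ ik) _ =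
        outside₂ (share₁₁ ik (j≢k ∘ sym)) (share₂₁ ik i≢l) (share₁₁ ik k≢l) (share₂₂ ik i≢j)
      pairing _ _ _ (inj₂ jl) =
        outside₂ (share₁₂ jl (i≢l ∘ sym)) (share₂₂ jl j≢k) (share₂₂ jl (i≢j ∘ sym)) (share₁₁ jl (k≢l ∘ sym))
      pairing (inj₁ ij) (inj₁ kl) (inj₁ ik) (inj₁ jl) = outside₃ ij kl ik jl

    packed-comb : ∀ {m} {w : Fin m → ℚ} {p : Fin m → Point n} → (∀ i → 0ℚ ≤ w i) → (∀ i → Packed (p i)) →
      Packed (comb m w p)
    packed-comb {m} {w} {p} 0≤w packed = record
      { nonNeg  = λ t → sum-nonNeg m (λ i → *-nonNeg (0≤w i) (Packed.nonNeg (packed i) t))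
      ; support = λ t → decide t (weight t ℕ.≟ n)
      }
      where
      decide : ∀ t → Dec (weight t ≡ n) → comb m w p t ≡ 0ℚ ⊎ weight t ≡ n
      decide t (yes e) = inj₂ e
      decide t (no ¬e) = inj₁ (sum-0 m λ i →
        [ (λ z → trans (cong (w i *_) z) (*-zeroʳ (w i))) , (λ e → contradiction e ¬e) ]′ (Packed.support (packed i) t))

    open Unit (_≟ₜ_ {n})

    packed-unit : ∀ {s} → weight s ≡ n → Packed (unit s)
    packed-unit {s} e = record
      { nonNeg  = λ t → [ (λ z → ≤-reflexive (sym z)) , (λ o → subst (0ℚ ≤_) (sym o) (<⇒≤ (positive⁻¹ 1ℚ))) ]′ (value t)
      ; support = λ t → decide t (s ≟ₜ t)
      }
      where
      value : ∀ t → unit s t ≡ 0ℚ ⊎ unit s t ≡ 1ℚ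
      value t with s ≟ₜ t
      ... | yes _ = inj₂ refl
      ... | no  _ = inj₁ refl
      decide : ∀ t → Dec (s ≡ t) → unit s t ≡ 0ℚ ⊎ weight t ≡ n
      decide t (yes refl) = inj₂ e
      decide t (no s≢t)   = inj₁ (unit-≢ s≢t)

    packing-simplex : ∀ {m} (T : Fin m → Triple n) → (∀ {i j} → T i ≡ T j → i ≡ j) →
      (∀ i → weight (T i) ≡ n) → ContainsSimplex n m
    packing-simplex {m} T injective weight≡n = p , affine , λ w 0≤w _ → packed⇒Dressian (packed-comb {w = w} {p} 0≤w packed)
      where
      open ≡-Reasoning
      p : Fin (suc m) → Point n
      p = cons (λ _ → 0ℚ) (λ i → unit (T i))
      packed : ∀ i → Packed (p i)
      packed zero    = record { nonNeg = λ _ → ≤-refl ; support = λ _ → inj₁ refl }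
      packed (suc i) = packed-unit {T i} (weight≡n i)
      affine : AffinelyIndependent m p
      affine c rel k = begin
        c k                                                   ≡⟨ *-identityʳ (c k) ⟨
        c k * (1ℚ - 0ℚ)                                       ≡⟨ cong (λ z → c k * (z - 0ℚ)) (unit-refl (T k)) ⟨
        c k * (unit (T k) (T k) - 0ℚ)                         ≡⟨ sum-single m k (λ i i≢k →
            trans (cong (λ z → c i * (z - 0ℚ)) (unit-≢ (i≢k ∘ injective))) (*-zeroʳ (c i))) ⟨
        sumFin m (λ i → c i * (unit (T i) (T k) - 0ℚ))        ≡⟨ rel (T k) ⟩
        0ℚ                                                    ∎

  module Packing {n m : ℕ} (5m≤n : 5 ℕ.* m ℕ.≤ n) where

    open Triple

    module _ (i j : Fin m) where
      -- `α` lies in [0, m) and `β` in [m, 2m), which gives `α < β`. For `β < γ` one needs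
      -- `α + 2β < n`, and `α + 2β` stays below 5m: hence the factor 5.
      α β γ : ℕ
      α = toℕ i
      β = m ℕ.+ toℕ j
      γ = n ℕ.∸ (α ℕ.+ β)

      β+α+β<n : suc β ℕ.+ (α ℕ.+ β) ℕ.≤ n
      β+α+β<n = ℕ.≤-trans (ℕ.+-mono-≤ β< (ℕ.+-mono-≤ (ℕ.<⇒≤ (Fin.toℕ<n i)) (ℕ.<⇒≤ β<)))
                  (subst (ℕ._≤ n) (five m) 5m≤n)
        where
        β< : β ℕ.< m ℕ.+ m
        β< = ℕ.+-monoʳ-< m (Fin.toℕ<n j)
        five : ∀ m → 5 ℕ.* m ≡ m ℕ.+ m ℕ.+ (m ℕ.+ (m ℕ.+ m))
        five = solve-∀

      α<β : α ℕ.< β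
      α<β = ℕ.<-≤-trans (Fin.toℕ<n i) (ℕ.m≤m+n m (toℕ j))

      β<γ : β ℕ.< γ
      β<γ = ℕ.m+n≤o⇒m≤o∸n (suc β) β+α+β<n

      α+β≤n : α ℕ.+ β ℕ.≤ n
      α+β≤n = ℕ.m+n≤o⇒n≤o (suc β) β+α+β<n

      -- Elements are counted from 0, so `γ` must not reach `n`; this holds because `α + β` is
      -- positive.
      γ<n : γ ℕ.< n
      γ<n = ℕ.∸-monoʳ-< {o = 0} (ℕ.<-≤-trans (ℕ.≤-<-trans z≤n α<β) (ℕ.m≤n+m β α)) α+β≤n

      block : Triple n
      block = triple (fromℕ< α<n) (fromℕ< β<n) (fromℕ< γ<n)
        (subst₂ ℕ._<_ (sym (Fin.toℕ-fromℕ< α<n)) (sym (Fin.toℕ-fromℕ< β<n)) α<β)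
        (subst₂ ℕ._<_ (sym (Fin.toℕ-fromℕ< β<n)) (sym (Fin.toℕ-fromℕ< γ<n)) β<γ)
        where
        β<n = ℕ.<-trans β<γ γ<n
        α<n = ℕ.<-trans α<β β<n

      a-block : toℕ (a block) ≡ α
      a-block = Fin.toℕ-fromℕ< _

      b-block : toℕ (b block) ≡ β
      b-block = Fin.toℕ-fromℕ< _

      weight-block : weight block ≡ n
      weight-block = trans (cong₂ ℕ._+_ (cong₂ ℕ._+_ a-block b-block) (Fin.toℕ-fromℕ< γ<n)) (ℕ.m+[n∸m]≡n α+β≤n)

    block-injective : ∀ {i j i′ j′} → block i j ≡ block i′ j′ → i ≡ i′ × j ≡ j′
    block-injective {i} {j} {i′} {j′} e =
      Fin.toℕ-injective (trans (sym (a-block i j)) (trans (cong (toℕ ∘ a) e) (a-block i′ j′))) ,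
      Fin.toℕ-injective (ℕ.+-cancelˡ-≡ m _ _ (trans (sym (b-block i j)) (trans (cong (toℕ ∘ b) e) (b-block i′ j′))))

    square-simplex : ContainsSimplex n (m ℕ.* m)
    square-simplex = packing-simplex (uncurry block ∘ remQuot {m} m)
      (λ {i} {j} e → let e₁ , e₂ = block-injective e in
        trans (sym (Fin.combine-remQuot {m} m i)) (trans (cong₂ Fin.combine e₁ e₂) (Fin.combine-remQuot {m} m j)))
      (λ i → uncurry weight-block (remQuot {m} m i))

-- Comparison of the constants.

open FanDimensions using (dimension)
open UpperBound using (simplex-bound)
open LowerBound using (module Packing)
open import Data.Nat using (_+_; _*_; _≤_; _∸_; _/_; _%_; s≤s⁻¹)
open import Data.Nat.Properties
open import Data.Nat.DivMod using (m≡m%n+[m/n]*n; m%n<n; /-monoˡ-≤; m/n*n≤m)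

-- The square on the left grows like 25 m² and `80 * D` provides 80 m². The remaining 55 m² pays for
-- the linear terms; after the shift `m = 10 + j` the difference, written out in `expand`, has only
-- nonnegative coefficients.
square-growth : ∀ j D → let m = 10 + j in m * m ≤ D →
  (5 * m + 4) * (5 * m + 4) + 80 * (5 * m + 5) ≤ 80 * D
square-growth j D m²≤D = ≤-trans
  (m+n≤o⇒m≤o _ (≤-reflexive (expand j)))
  (*-monoʳ-≤ 80 m²≤D)
  where
  expand : ∀ j → (5 * (10 + j) + 4) * (5 * (10 + j) + 4) + 80 * (5 * (10 + j) + 5) + (684 + 660 * j + 55 * (j * j))
    ≡ 80 * ((10 + j) * (10 + j))
  expand = solve-∀

theorem3p6 : ∃[ a ] ∃[ b ] ∃[ N ] ((n : ℕ) → N ≤ n →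
    ∃[ d ] (ComplexDimension n d × n * n ≤ (1 + a) * d × d ≤ (1 + b) * (n * n)))
-- `1 + a` is the 80 of `square-growth`, 50 ensures `n / 5 ≥ 10` where that lemma starts, and
-- `1 + b` is the factor 2 of `simplex-bound`.
theorem3p6 = 79 , 1 , 50 , λ n 50≤n →
  let m = n / 5
      5m≤n : 5 * m ≤ n
      5m≤n = subst (_≤ n) (*-comm m 5) (m/n*n≤m n 5)
      D , m²≤D , fan = dimension (Packing.square-simplex {n} {m} 5m≤n)
      lower , n<D = arithmetic n D (m≤n⇒∃ (/-monoˡ-≤ 5 50≤n)) m²≤D
      D≡ = D-split n D n<D
  in D ∸ suc n , subst (FanDimension n) D≡ fan , lower ,
     ≤-trans (m∸n≤m D (suc n)) (subst (D ≤_) (rearrange n) (simplex-bound (proj₁ fan)))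
  where
  m≤n⇒∃ : ∀ {m n} → m ≤ n → ∃[ j ] n ≡ m + j
  m≤n⇒∃ {m} {n} m≤n = n ∸ m , sym (m+[n∸m]≡n m≤n)
  rearrange : ∀ n → n * (n * 2) ≡ 2 * (n * n)
  rearrange = solve-∀
  n≤5m+4 : ∀ n → n ≤ 5 * (n / 5) + 4
  n≤5m+4 n = subst (_≤ 5 * (n / 5) + 4) (sym (m≡m%n+[m/n]*n n 5))
    (subst (n % 5 + n / 5 * 5 ≤_) (swap (n / 5)) (+-monoˡ-≤ (n / 5 * 5) (s≤s⁻¹ (m%n<n n 5))))
    where swap : ∀ m → 4 + m * 5 ≡ 5 * m + 4
          swap = solve-∀
  D-split : ∀ n D → suc n ≤ D → D ≡ D ∸ suc n + n + 1
  D-split n D n<D = trans (sym (m∸n+n≡m n<D)) (last (D ∸ suc n) n)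
    where last : ∀ d n → d + suc n ≡ d + n + 1
          last = solve-∀
  -- Both claims come from `n * n + 80 * suc n ≤ 80 * D`. Dropping the square gives `n < D`, so the
  -- truncated subtraction of the lineality and the sphere is exact; moving `80 * suc n` across
  -- gives the lower bound.
  arithmetic : ∀ n D → ∃[ j ] n / 5 ≡ 10 + j → n / 5 * (n / 5) ≤ D →
    n * n ≤ 80 * (D ∸ suc n) × suc n ≤ D
  arithmetic n D (j , e) m²≤D =
    subst (n * n ≤_) (sym (*-distribˡ-∸ 80 D (suc n))) (m+n≤o⇒m≤o∸n (n * n) total) ,
    *-cancelˡ-≤ 80 (m+n≤o⇒n≤o (n * n) total)
    where
    n≤ : n ≤ 5 * (10 + j) + 4
    n≤ = subst (λ m → n ≤ 5 * m + 4) e (n≤5m+4 n)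
    total : n * n + 80 * suc n ≤ 80 * D
    total = ≤-trans
      (+-mono-≤ (*-mono-≤ n≤ n≤) (*-monoʳ-≤ 80 (subst (suc n ≤_) (sym (+-suc (5 * (10 + j)) 4)) (s≤s n≤))))
      (square-growth j D (subst (λ m → m * m ≤ D) e m²≤D))
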